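{- For all graphs $F$ and $G$ with $F\to G$, \[ \mathsf{HDE}(F,G) \;\le\; \min_{q \in \mathcal Q(G)}\; \max_{\varphi \in \mathsf{Hom}(F,G)}\; \sum_{A\subseteq V_G} q(A)\cdot \mathsf{CC}\big(F|_{\varphi^{ -1}(A)}\big). \]
   Context: Graphs are finite directed graphs $G=(V_G,E_G)$ with $V_G$ nonempty finite and $E_G\subseteq V_G\times V_G$ (loops allowed). A homomorphism $\varphi:F\to G$ is a map $V_F\to V_G$ with $(\varphi(a),\varphi(b))\in E_G$ for all $(a,b)\in E_F$; $\mathsf{Hom}(F,G)$ is the set of these, $\hom(F,G)$ its size, $F\to G$ means $\hom(F,G)\ge 1$. For $F\to G$, $\mathsf{HDE}(F,G)=\sup\{c\in\mathbb R:\hom(F,T)\ge\hom(G,T)^c\text{ for all graphs }T\}$. For $A\subseteq V_G$, $G|_A$ is the induced subgraph on $A$; $\mathsf{CC}(H)$ is the number of connected components of the underlying undirected graph of $H$ (edges ignoring direction), with $\mathsf{CC}(G|_\emptyset)=0$. $\mathcal Q(G)$ is the set of functions $q:\wp(V_G)\to\mathbb R$ with $q(\emptyset)=0$, $q(A)\ge0$ for all $A$, and $\sum_{A\subseteq V_G} q(A)\,\mathsf{CC}(G|_A)=1$. -}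

module Defs where

open import Level using (Level; 0ℓ) renaming (suc to lsuc; _⊔_ to _⊔ˡ_)
import Data.Empty as Empty
open import Data.Bool.Base using (Bool; T)
open import Data.Bool.Properties using (T?)
open import Data.Nat.Base as ℕ using (ℕ; zero; suc; NonZero)
open import Data.Integer.Base using (+_; -[1+_])
open import Data.Rational.Base as ℚ using (ℚ; mkℚ; 0ℚ; 1ℚ)
import Data.Rational.Properties as ℚ
open import Data.Fin.Base as Fin using (Fin; finToFun)
import Data.Fin.Properties as Fin
open import Data.Fin.Subset using (Subset; inside; outside; _∈_; ⊥)
open import Data.Fin.Subset.Properties using (_∈?_)
open import Data.Vec.Base using ([]; _∷_; lookup; tabulate)
open import Data.List.Base as List
  using (List; []; _∷_; length; filter; allFin; cartesianProduct)
open import Data.List.Relation.Unary.Any using (here; there)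
import Data.List.Membership.Propositional as List
open import Data.List.Membership.Propositional.Properties
  using (∈-filter⁺; ∈-filter⁻; ∈-allFin; ∈-cartesianProduct⁺)
open import Data.Product.Base using (∃; ∃₂; _×_; _,_; proj₂)
open import Data.Sum.Base using (_⊎_; inj₁; inj₂)
open import Relation.Binary.Core using (Rel)
import Relation.Binary.Definitions as B
open import Relation.Binary.Construct.Closure.Equivalence using (EqClosure)
open import Relation.Binary.Construct.Closure.ReflexiveTransitive using (ε; _◅_; _◅◅_)
open import Relation.Binary.Construct.Closure.Symmetric using (fwd; bwd)
open import Relation.Binary.PropositionalEquality using (_≡_; refl)
open import Relation.Nullary using (Dec)
open import Relation.Nullary.Decidable using (map′; _×-dec_; _⊎-dec_; _→-dec_)
open import Relation.Unary using (Pred)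

private
  variable
    a b ℓ : Level
    n : ℕ

------------------------------------------------------------------------
-- Real numbers, as lower Dedekind cuts of ℚ.
--
-- A real x is given by the rationals strictly below it: a nonempty,
-- bounded above, downward closed set of rationals without a greatest
-- element.  Dropping "nonempty" and "bounded" leaves the extended reals,
-- in which every set has a supremum.

record ExtReal (ℓ : Level) : Set (lsuc ℓ) where
  field
    Below : Pred ℚ ℓ
    down  : ∀ {r s} → r ℚ.< s → Below s → Below r
    open′ : ∀ {r} → Below r → ∃ λ s → r ℚ.< s × Below s

open ExtReal public

record ℝ : Set₁ where
  field
    cut       : ExtReal 0ℓ
    inhabited : ∃ (Below cut)
    bounded   : ∃ λ u → ∀ {r} → Below cut r → r ℚ.< u

open ℝ public

infix 4 _≤_ _≈_
infixl 6 _+_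
infixl 7 _·_

_≤_ : ExtReal a → ExtReal b → Set (a ⊔ˡ b)
x ≤ y = ∀ {r} → Below x r → Below y r

_≈_ : ExtReal a → ExtReal b → Set (a ⊔ˡ b)
x ≈ y = (x ≤ y) × (y ≤ x)

private
  p-1<p : ∀ p → p ℚ.+ ℚ.- 1ℚ ℚ.< p
  p-1<p p with ℚ.+-monoʳ-< p (ℚ.negative⁻¹ (ℚ.- 1ℚ))
  ... | h rewrite ℚ.+-identityʳ p = h

fromℚ : ℚ → ℝ
fromℚ p = record
  { cut = record
    { Below = ℚ._< p
    ; down  = ℚ.<-trans
    ; open′ = λ r<p → let s , r<s , s<p = ℚ.<-dense r<p in s , r<s , s<p
    }
  ; inhabited = _ , p-1<p p
  ; bounded   = p , λ r<p → r<p
  }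

0ℝ 1ℝ : ℝ
0ℝ = fromℚ 0ℚ
1ℝ = fromℚ 1ℚ

_+_ : ℝ → ℝ → ℝ
x + y = record
  { cut = record
    { Below = λ r → ∃₂ λ p q → Below (cut x) p × Below (cut y) q × r ℚ.< p ℚ.+ q
    ; down  = λ { r<s (p , q , p∈x , q∈y , s<p+q) →
                  p , q , p∈x , q∈y , ℚ.<-trans r<s s<p+q }
    ; open′ = λ { (p , q , p∈x , q∈y , r<p+q) →
                  let s , r<s , s<p+q = ℚ.<-dense r<p+q
                  in s , r<s , p , q , p∈x , q∈y , s<p+q }
    }
  ; inhabited =
      let p , p∈x = inhabited x
          q , q∈y = inhabited y
      in _ , p , q , p∈x , q∈y , p-1<p (p ℚ.+ q)
  ; bounded =
      let u , x<u = bounded x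
          v , y<v = bounded y
      in u ℚ.+ v , λ { (p , q , p∈x , q∈y , r<p+q) →
           ℚ.<-trans r<p+q (ℚ.+-mono-< (x<u p∈x) (y<v q∈y)) }
  }

-- Only products of a real with a natural number are needed.
_·_ : ℝ → ℕ → ℝ
x · zero  = 0ℝ
x · suc k = x + x · k

sup : (ℝ → Set ℓ) → ExtReal (lsuc 0ℓ ⊔ˡ ℓ)
sup S = record
  { Below = λ r → ∃ λ x → S x × Below (cut x) r
  ; down  = λ { r<s (x , Sx , s∈x) → x , Sx , down (cut x) r<s s∈x }
  ; open′ = λ { (x , Sx , r∈x) →
                let s , r<s , s∈x = open′ (cut x) r∈x in s , r<s , x , Sx , s∈x }
  }

-∞ : ExtReal 0ℓ
-∞ = record { Below = λ _ → Empty.⊥ ; down = λ _ () ; open′ = λ () }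

infixl 6 _⊔_

_⊔_ : ExtReal a → ExtReal b → ExtReal (a ⊔ˡ b)
x ⊔ y = record
  { Below = λ r → Below x r ⊎ Below y r
  ; down  = λ { r<s (inj₁ s∈x) → inj₁ (down x r<s s∈x)
              ; r<s (inj₂ s∈y) → inj₂ (down y r<s s∈y) }
  ; open′ = λ { (inj₁ r∈x) → let s , r<s , s∈x = open′ x r∈x in s , r<s , inj₁ s∈x
              ; (inj₂ r∈y) → let s , r<s , s∈y = open′ y r∈y in s , r<s , inj₂ s∈y }
  }

max : List ℝ → ExtReal 0ℓ
max = List.foldr (λ x → cut x ⊔_) -∞

IsMinimum : {I : Set a} → (I → ExtReal 0ℓ) → ℝ → Set a
IsMinimum f m = (∃ λ i → f i ≈ cut m) × (∀ i → cut m ≤ f i)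

∑⊆ : (Subset n → ℝ) → ℝ
∑⊆ {zero}  f = f []
∑⊆ {suc n} f = ∑⊆ (λ A → f (outside ∷ A)) + ∑⊆ (λ A → f (inside ∷ A))

------------------------------------------------------------------------
-- Graphs and homomorphisms

record Graph : Set where
  field
    order        : ℕ
    {{nonempty}} : NonZero order
    edge         : Fin order → Fin order → Bool

open Graph public

V : Graph → Set
V G = Fin (order G)

Edge : (G : Graph) → Rel (V G) 0ℓ
Edge G u v = T (edge G u v)

IsHom : (F G : Graph) → (V F → V G) → Set
IsHom F G φ = ∀ u v → Edge F u v → Edge G (φ u) (φ v)

isHom? : ∀ F G φ → Dec (IsHom F G φ)
isHom? F G φ = Fin.all? λ u → Fin.all? λ v →
  T? (edge F u v) →-dec T? (edge G (φ u) (φ v))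

-- finToFun lists every function V F → V G exactly once.
Hom : (F G : Graph) → List (V F → V G)
Hom F G = filter (isHom? F G)
  (List.map finToFun (allFin (order G ℕ.^ order F)))

hom : Graph → Graph → ℕ
hom F G = length (Hom F G)

infix 4 _⟶_

_⟶_ : Graph → Graph → Set
F ⟶ G = 1 ℕ.≤ hom F G

------------------------------------------------------------------------
-- Homomorphism domination exponent

-- n ^ r ≤ m for a rational exponent r = p / d, with n ≥ 1:
-- n ^ p ≤ m ^ d, a negative power of n being moved to the right.
RatPow≤ : ℕ → ℚ → ℕ → Set
RatPow≤ n (mkℚ (+ p)    d-1 _) m = n ℕ.^ p ℕ.≤ m ℕ.^ suc d-1
RatPow≤ n (mkℚ -[1+ p ] d-1 _) m = 1 ℕ.≤ m ℕ.^ suc d-1 ℕ.* n ℕ.^ suc p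

-- n ^ c ≤ m for a real exponent c, where n ^ c = sup { n ^ r | r < c }
-- for n ≥ 1.  A zero base gives no constraint: 0 ^ c = 0 for c > 0, and
-- this is extended to c ≤ 0.
Pow≤ : ℕ → ℝ → ℕ → Set
Pow≤ n c m = 1 ℕ.≤ n → ∀ {r} → Below (cut c) r → RatPow≤ n r m

HDE : Graph → Graph → ExtReal (lsuc 0ℓ)
HDE F G = sup λ c → ∀ (T : Graph) → Pow≤ (hom G T) c (hom F T)

------------------------------------------------------------------------
-- Decidability of the equivalence closure of a decidable relation on
-- Fin n: equivalence classes are merged along the pairs of the relation,
-- one pair at a time.

private
  Merged : List (Fin n × Fin n) → Rel (Fin n) 0ℓ
  Merged []             u v = u ≡ v
  Merged ((x , y) ∷ es) u v =
    Merged es u v ⊎ (Merged es u x × Merged es y v) ⊎ (Merged es u y × Merged es x v)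

  merged? : (es : List (Fin n × Fin n)) → B.Decidable (Merged es)
  merged? []             u v = u Fin.≟ v
  merged? ((x , y) ∷ es) u v =
    merged? es u v ⊎-dec (merged? es u x ×-dec merged? es y v)
                   ⊎-dec (merged? es u y ×-dec merged? es x v)

  M-refl : (es : List (Fin n × Fin n)) → B.Reflexive (Merged es)
  M-refl []       = refl
  M-refl (_ ∷ es) = inj₁ (M-refl es)

  M-sym : (es : List (Fin n × Fin n)) → B.Symmetric (Merged es)
  M-sym []       refl = refl
  M-sym (_ ∷ es) (inj₁ p)              = inj₁ (M-sym es p)
  M-sym (_ ∷ es) (inj₂ (inj₁ (p , q))) = inj₂ (inj₂ (M-sym es q , M-sym es p))
  M-sym (_ ∷ es) (inj₂ (inj₂ (p , q))) = inj₂ (inj₁ (M-sym es q , M-sym es p))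

  M-trans : (es : List (Fin n × Fin n)) → B.Transitive (Merged es)
  M-trans []       refl q = q
  M-trans (_ ∷ es) (inj₁ p) (inj₁ q) = inj₁ (M-trans es p q)
  M-trans (_ ∷ es) (inj₁ p) (inj₂ (inj₁ (q , r))) = inj₂ (inj₁ (M-trans es p q , r))
  M-trans (_ ∷ es) (inj₁ p) (inj₂ (inj₂ (q , r))) = inj₂ (inj₂ (M-trans es p q , r))
  M-trans (_ ∷ es) (inj₂ (inj₁ (p , q))) (inj₁ r) = inj₂ (inj₁ (p , M-trans es q r))
  M-trans (_ ∷ es) (inj₂ (inj₁ (p , q))) (inj₂ (inj₁ (r , s))) = inj₂ (inj₁ (p , s))
  M-trans (_ ∷ es) (inj₂ (inj₁ (p , q))) (inj₂ (inj₂ (r , s))) = inj₁ (M-trans es p s)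
  M-trans (_ ∷ es) (inj₂ (inj₂ (p , q))) (inj₁ r) = inj₂ (inj₂ (p , M-trans es q r))
  M-trans (_ ∷ es) (inj₂ (inj₂ (p , q))) (inj₂ (inj₁ (r , s))) = inj₁ (M-trans es p s)
  M-trans (_ ∷ es) (inj₂ (inj₂ (p , q))) (inj₂ (inj₂ (r , s))) = inj₂ (inj₂ (p , s))

  M-∈ : ∀ (es : List (Fin n × Fin n)) {u v} → (u , v) List.∈ es → Merged es u v
  M-∈ (_ ∷ es) (here refl) = inj₂ (inj₁ (M-refl es , M-refl es))
  M-∈ (_ ∷ es) (there uv∈) = inj₁ (M-∈ es uv∈)

module _ {R : Rel (Fin n) 0ℓ} (R? : B.Decidable R) where

  private
    pairs : List (Fin n × Fin n)
    pairs = filter (λ (u , v) → R? u v) (cartesianProduct (allFin n) (allFin n))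

    R⇒M : ∀ {u v} → R u v → Merged pairs u v
    R⇒M Ruv = M-∈ pairs
      (∈-filter⁺ (λ (u , v) → R? u v) (∈-cartesianProduct⁺ (∈-allFin _) (∈-allFin _)) Ruv)

    complete : ∀ {u v} → EqClosure R u v → Merged pairs u v
    complete ε            = M-refl pairs
    complete (fwd r ◅ rs) = M-trans pairs (R⇒M r) (complete rs)
    complete (bwd r ◅ rs) = M-trans pairs (M-sym pairs (R⇒M r)) (complete rs)

    sound : ∀ es → (∀ {u v} → (u , v) List.∈ es → R u v) →
            ∀ {u v} → Merged es u v → EqClosure R u v
    sound []       _ refl = ε
    sound (_ ∷ es) h (inj₁ p) = sound es (λ i → h (there i)) p
    sound (_ ∷ es) h (inj₂ (inj₁ (p , q))) =
      sound es (λ i → h (there i)) p ◅◅ fwd (h (here refl)) ◅ sound es (λ i → h (there i)) q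
    sound (_ ∷ es) h (inj₂ (inj₂ (p , q))) =
      sound es (λ i → h (there i)) p ◅◅ bwd (h (here refl)) ◅ sound es (λ i → h (there i)) q

  eqClosure? : B.Decidable (EqClosure R)
  eqClosure? u v = map′
    (sound pairs λ i → proj₂ (∈-filter⁻ (λ (u , v) → R? u v) {xs = cartesianProduct (allFin n) (allFin n)} i))
    complete
    (merged? pairs u v)

------------------------------------------------------------------------
-- Connected components of induced subgraphs

module _ (G : Graph) (A : Subset (order G)) where

  InducedEdge : Rel (V G) 0ℓ
  InducedEdge u v = u ∈ A × v ∈ A × Edge G u v

  -- For vertices of A: connected in the underlying undirected graph of
  -- G|A.  A vertex outside A is related to itself only.
  Connected : Rel (V G) 0ℓ
  Connected = EqClosure InducedEdge

  connected? : B.Decidable Connected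
  connected? = eqClosure? λ u v → (u ∈? A) ×-dec (v ∈? A) ×-dec T? (edge G u v)

  IsRepresentative : V G → Set
  IsRepresentative v = v ∈ A × (∀ w → Connected v w → v Fin.≤ w)

  isRepresentative? : ∀ v → Dec (IsRepresentative v)
  isRepresentative? v =
    (v ∈? A) ×-dec Fin.all? (λ w → connected? v w →-dec (v Fin.≤? w))

  -- Components are counted by their least vertices.
  CC : ℕ
  CC = length (filter isRepresentative? (allFin (order G)))

------------------------------------------------------------------------
-- The optimisation problem

record 𝒬 (G : Graph) : Set₁ where
  field
    weight      : Subset (order G) → ℝ
    weight-⊥    : cut (weight ⊥) ≈ cut 0ℝ
    weight-≥0   : ∀ A → cut 0ℝ ≤ cut (weight A)
    normalised  : cut (∑⊆ λ A → weight A · CC G A) ≈ cut 1ℝ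

open 𝒬 public

preimage : ∀ {m n} → (Fin m → Fin n) → Subset n → Subset m
preimage φ A = tabulate λ v → lookup A (φ v)

value : (F G : Graph) → 𝒬 G → (V F → V G) → ℝ
value F G q φ = ∑⊆ λ A → weight q A · CC F (preimage φ A)

-- If F ⟶ G then Hom F G is nonempty, so that this is not −∞.
objective : (F G : Graph) → 𝒬 G → ExtReal 0ℓ
objective F G q = max (List.map (value F G q) (Hom F G))

-- The problem min over q of max over φ is a rational linear program, so Fourier–Motzkin
-- elimination yields a rational optimum q, t.  It is also optimal among real weightings: these are
-- approximated from below by rational ones, and minimality of t is homogeneous in the weighting.
--
-- For the bound, write q A = w A / D and let T be the blow-up of G in which a vertex over v carries
-- w A colours from [N] for each A ∋ v, adjacent vertices over A having the same colours for A.  A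
-- homomorphism to T over φ amounts to a choice of colours for the components of all the preimages
-- φ⁻¹(A).  Hence hom(G,T) ≥ N ^ ∑ w A CC(G|A) = N ^ D, taking φ = id, and
-- hom(F,T) ≤ hom(F,G) N ^ E whenever E bounds ∑ w A CC(F|φ⁻¹(A)) ≤ D t for all φ.  Letting N grow
-- gives c ≤ t.

module Submission where

open import Defs
open import Data.Product.Base using (∃; _×_)
open import Level using (0ℓ)
open import Algebra.Properties.CommutativeSemigroup using (interchange)
open import Data.Bool.Base using (true; false)
open import Data.Bool.Properties using (T?)
open import Data.Nat.Base as ℕ using (ℕ; zero; suc)
import Data.Nat.Properties as ℕ
import Data.Nat.DivMod as ℕ
open import Data.Nat.Coprimality using (Coprime; 1-coprimeTo) renaming (sym to coprime-sym)
open import Data.Nat.ListAction using (sum)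
open import Data.Nat.ListAction.Properties using (sum-++)
open import Data.Integer.Base as ℤ using (+_; -[1+_])
import Data.Integer.Properties as ℤ
open import Data.Rational.Base as ℚ using (ℚ; mkℚ; 0ℚ; 1ℚ)
import Data.Rational.Properties as ℚ
open import Data.Rational.Solver using (module +-*-Solver)
import Data.Rational.Unnormalised.Base as ℚᵘ
import Data.Rational.Unnormalised.Properties as ℚᵘ
open import Data.Fin.Base as Fin
  using (Fin; zero; suc; finToFun; funToFin; combine; quotient; remainder; inject≤)
import Data.Fin.Properties as Fin
open import Data.Fin.Subset using (Subset; inside; outside; ⊥; ⊤; _∈_; _∉_)
open import Data.Fin.Subset.Properties using (_∈?_; ∈⊤)
open import Data.Vec.Base as Vec using (Vec; []; _∷_)
import Data.Vec.Properties as Vec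
import Data.Vec.Relation.Unary.All as Vec using (All; []; _∷_)
import Data.Vec.Relation.Unary.All.Properties as VecAll
open import Data.List.Base as List
  using (List; []; _∷_; length; filter; allFin; cartesianProduct; cartesianProductWith)
import Data.List.Properties as List
open import Data.List.Relation.Unary.All as All using (All; []; _∷_)
import Data.List.Relation.Unary.All.Properties as All
open import Data.List.Relation.Unary.AllPairs using (_∷_)
open import Data.List.Relation.Unary.Any as Any using (Any; here; there; index)
import Data.List.Relation.Unary.Any.Properties as Any
import Data.List.Membership.Propositional as List
open import Data.List.Membership.Propositional using (find)
import Data.List.Membership.Propositional.Properties as List
open import Data.List.Relation.Unary.Unique.Propositional using (Unique)
import Data.List.Relation.Unary.Unique.Propositional.Properties as Unique
open import Data.Product.Base using (∃₂; _,_; proj₁; proj₂)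
open import Data.Sum.Base using (inj₁; inj₂)
open import Function.Base using (_∘_; const)
open import Function.Definitions using (Injective)
import Relation.Binary.Construct.Closure.Equivalence as EqClosure
open import Relation.Binary.Definitions using (tri<; tri≈; tri>)
open import Relation.Binary.PropositionalEquality
open import Relation.Nullary using (Dec; yes; no; contradiction)
open import Relation.Nullary.Decidable
  using (_×-dec_; _→-dec_; ¬?; ⌊_⌋; toWitness; fromWitness)
open import Relation.Unary using (Pred; Decidable)

-- A real is a lower cut: it offers rational approximations from below, and comparisons of reals are
-- not decidable. This is why an exact rational optimum is computed, and it shapes the comparison
-- with real weightings. An approximation from below may have total `s < 1` and then is not a
-- weighting. Division by `s` makes it one, so some `φ` gives it a value of at least `s t`, and `s`
-- can be brought as close to 1 as desired. In the bound, `D t` need not be an integer, but the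
-- component counts are. If `t < p / d`, every count `k ≤ D t` satisfies `k d < D p`, so an integer
-- `E` bounds all counts while `E d < D p` stays strict. Then `N ^ (D p) ≤ (hom(F,G) N ^ E) ^ d`
-- already fails at `N = hom(F,G) ^ d + 1`, and no limit has to be taken.

0≤q-p⇒p≤q : ∀ {p q} → 0ℚ ℚ.≤ q ℚ.- p → p ℚ.≤ q
0≤q-p⇒p≤q {p} {q} h = subst₂ ℚ._≤_ (ℚ.+-identityʳ p) eq (ℚ.+-monoʳ-≤ p h)
  where
  open +-*-Solver
  eq : p ℚ.+ (q ℚ.- p) ≡ q
  eq = solve 2 (λ p q → p :+ (q :- p) := q) refl p q

p≤q⇒0≤q-p : ∀ {p q} → p ℚ.≤ q → 0ℚ ℚ.≤ q ℚ.- p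
p≤q⇒0≤q-p {p} {q} h = subst (ℚ._≤ q ℚ.- p) (ℚ.+-inverseʳ p) (ℚ.+-monoˡ-≤ (ℚ.- p) h)

-- The default `0ℚ` is the lower bound that all variables obey, so the `maximum` of the remaining
-- lower bounds is the least admissible value.
maximum : List ℚ → ℚ
maximum = List.foldr ℚ._⊔_ 0ℚ

0≤maximum : ∀ ps → 0ℚ ℚ.≤ maximum ps
0≤maximum []       = ℚ.≤-refl
0≤maximum (p ∷ ps) = ℚ.≤-trans (0≤maximum ps) (ℚ.p≤q⊔p p (maximum ps))

≤maximum : ∀ ps → All (ℚ._≤ maximum ps) ps
≤maximum []       = []
≤maximum (p ∷ ps) =
  ℚ.p≤p⊔q p (maximum ps) ∷ All.map (λ h → ℚ.≤-trans h (ℚ.p≤q⊔p p (maximum ps))) (≤maximum ps)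

maximum≤ : ∀ {ps q} → 0ℚ ℚ.≤ q → All (ℚ._≤ q) ps → maximum ps ℚ.≤ q
maximum≤ 0≤q []       = 0≤q
maximum≤ 0≤q (h ∷ hs) = ℚ.⊔-lub h (maximum≤ 0≤q hs)

-- Linear programming over ℚ, in non-negative variables

Affine : ℕ → Set
Affine n = ℚ × Vec ℚ n

dot : ∀ {n} → Vec ℚ n → Vec ℚ n → ℚ
dot []       []       = 0ℚ
dot (a ∷ as) (x ∷ xs) = a ℚ.* x ℚ.+ dot as xs

eval : ∀ {n} → Affine n → Vec ℚ n → ℚ
eval (c , as) xs = c ℚ.+ dot as xs

infixl 6 _⊖_
infixl 7 _⊙_

_⊙_ : ∀ {n} → ℚ → Affine n → Affine n
k ⊙ (c , as) = k ℚ.* c , Vec.map (k ℚ.*_) as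

_⊖_ : ∀ {n} → Affine n → Affine n → Affine n
(c , as) ⊖ (d , bs) = c ℚ.- d , Vec.zipWith ℚ._-_ as bs

eval-⊙ : ∀ {n} k (f : Affine n) x → eval (k ⊙ f) x ≡ k ℚ.* eval f x
eval-⊙ k (c , as) x = trans (cong (k ℚ.* c ℚ.+_) (dot-map as x)) (sym (ℚ.*-distribˡ-+ k c _))
  where
  dot-map : ∀ {n} (as x : Vec ℚ n) → dot (Vec.map (k ℚ.*_) as) x ≡ k ℚ.* dot as x
  dot-map []       []       = sym (ℚ.*-zeroʳ k)
  dot-map (a ∷ as) (x ∷ xs) rewrite dot-map as xs =
    solve 4 (λ k a x d → k :* a :* x :+ k :* d := k :* (a :* x :+ d)) refl k a x (dot as xs)
    where open +-*-Solver

eval-⊖ : ∀ {n} (f g : Affine n) x → eval (f ⊖ g) x ≡ eval f x ℚ.- eval g x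
eval-⊖ (c , as) (d , bs) x = trans (cong (c ℚ.- d ℚ.+_) (dot-zip as bs x))
  (solve 4 (λ c d p q → c :- d :+ (p :- q) := c :+ p :- (d :+ q)) refl c d (dot as x) (dot bs x))
  where
  open +-*-Solver
  dot-zip : ∀ {n} (as bs x : Vec ℚ n) → dot (Vec.zipWith ℚ._-_ as bs) x ≡ dot as x ℚ.- dot bs x
  dot-zip []       []       []       = refl
  dot-zip (a ∷ as) (b ∷ bs) (x ∷ xs) rewrite dot-zip as bs xs =
    solve 5 (λ a b x d e → (a :- b) :* x :+ (d :- e) := a :* x :+ d :- (b :* x :+ e))
      refl a b x (dot as xs) (dot bs xs)

dot-++ : ∀ {m n} (as x : Vec ℚ m) {bs y : Vec ℚ n} →
         dot (as Vec.++ bs) (x Vec.++ y) ≡ dot as x ℚ.+ dot bs y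
dot-++ []       []       = sym (ℚ.+-identityˡ _)
dot-++ (a ∷ as) (x ∷ xs) = trans (cong (a ℚ.* x ℚ.+_) (dot-++ as xs))
  (sym (ℚ.+-assoc (a ℚ.* x) (dot as xs) _))

NonNeg : ∀ {n} → Vec ℚ n → Set
NonNeg = Vec.All (0ℚ ℚ.≤_)

Sat : ∀ {n} → List (Affine n) → Vec ℚ n → Set
Sat S x = All (λ f → 0ℚ ℚ.≤ eval f x) S

record Bounds (n : ℕ) : Set where
  constructor bounds
  field
    free lower upper : List (Affine n)

record Within {n} (B : Bounds n) (x₀ : ℚ) (x : Vec ℚ n) : Set where
  constructor within
  open Bounds B
  field
    free-≥0 : Sat free x
    lower-≤ : All (λ f → eval f x ℚ.≤ x₀) lower
    upper-≥ : All (λ f → x₀ ℚ.≤ eval f x) upper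

module _ (a : ℚ) .{{_ : ℚ.NonZero a}} {n} (c : ℚ) (as : Vec ℚ n) where

  solveFor₀ : Affine n
  solveFor₀ = ℚ.- (ℚ.1/ a) ⊙ (c , as)

  -- A row is `a` times the distance of `x₀` from the root of the row, so the sign of `a` decides
  -- whether the root bounds `x₀` from below or from above.
  a*[x-solveFor₀] : ∀ x₀ x → a ℚ.* (x₀ ℚ.- eval solveFor₀ x) ≡ eval (c , a ∷ as) (x₀ ∷ x)
  a*[x-solveFor₀] x₀ x rewrite eval-⊙ (ℚ.- (ℚ.1/ a)) (c , as) x = begin
    a ℚ.* (x₀ ℚ.- (ℚ.- i) ℚ.* (c ℚ.+ d))
      ≡⟨ solve 5 (λ a x₀ i c d →
           a :* (x₀ :- (:- i) :* (c :+ d)) := a :* x₀ :+ (a :* i) :* (c :+ d)) refl a x₀ i c d ⟩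
    a ℚ.* x₀ ℚ.+ (a ℚ.* i) ℚ.* (c ℚ.+ d)
      ≡⟨ cong (λ k → a ℚ.* x₀ ℚ.+ k ℚ.* (c ℚ.+ d)) (ℚ.*-inverseʳ a) ⟩
    a ℚ.* x₀ ℚ.+ 1ℚ ℚ.* (c ℚ.+ d)
      ≡⟨ solve 4 (λ a x₀ c d → a :* x₀ :+ con 1ℚ :* (c :+ d) := c :+ (a :* x₀ :+ d)) refl a x₀ c d ⟩
    c ℚ.+ (a ℚ.* x₀ ℚ.+ d)
      ∎
    where
    open ≡-Reasoning
    open +-*-Solver
    i = ℚ.1/ a
    d = dot as x

split : ∀ {n} → List (Affine (suc n)) → Bounds n
split [] = bounds [] [] []
split ((c , a ∷ as) ∷ S) with split S | ℚ.<-cmp a 0ℚ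
... | bounds zs ls us | tri< a<0 _ _ =
  bounds zs ls (solveFor₀ a {{ℚ.neg⇒nonZero a {{ℚ.negative a<0}}}} c as ∷ us)
... | bounds zs ls us | tri≈ _ _ _ = bounds ((c , as) ∷ zs) ls us
... | bounds zs ls us | tri> _ _ a>0 =
  bounds zs (solveFor₀ a {{ℚ.pos⇒nonZero a {{ℚ.positive a>0}}}} c as ∷ ls) us

0≤pos*p⇒0≤p : ∀ a {p} .{{_ : ℚ.Positive a}} → 0ℚ ℚ.≤ a ℚ.* p → 0ℚ ℚ.≤ p
0≤pos*p⇒0≤p a {p} h = ℚ.*-cancelˡ-≤-pos a (subst (ℚ._≤ a ℚ.* p) (sym (ℚ.*-zeroʳ a)) h)

0≤neg*p⇒p≤0 : ∀ a {p} .{{_ : ℚ.Negative a}} → 0ℚ ℚ.≤ a ℚ.* p → p ℚ.≤ 0ℚ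
0≤neg*p⇒p≤0 a {p} h = ℚ.*-cancelˡ-≤-neg a (subst (ℚ._≤ a ℚ.* p) (sym (ℚ.*-zeroʳ a)) h)

0≤* : ∀ {p q} → 0ℚ ℚ.≤ p → 0ℚ ℚ.≤ q → 0ℚ ℚ.≤ p ℚ.* q
0≤* {p} {q} 0≤p 0≤q = ℚ.nonNegative⁻¹ (p ℚ.* q)
  {{ℚ.nonNeg*nonNeg⇒nonNeg p {{ℚ.nonNegative 0≤p}} q {{ℚ.nonNegative 0≤q}}}}

nonPos*nonPos⇒0≤ : ∀ {p q} → p ℚ.≤ 0ℚ → q ℚ.≤ 0ℚ → 0ℚ ℚ.≤ p ℚ.* q
nonPos*nonPos⇒0≤ {p} {q} p≤0 q≤0 = ℚ.nonNegative⁻¹ (p ℚ.* q)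
  {{ℚ.nonPos*nonPos⇒nonPos p {{ℚ.nonPositive p≤0}} q {{ℚ.nonPositive q≤0}}}}

p≤q⇒p-q≤0 : ∀ {p q} → p ℚ.≤ q → p ℚ.- q ℚ.≤ 0ℚ
p≤q⇒p-q≤0 {p} {q} h = subst (p ℚ.- q ℚ.≤_) (ℚ.+-inverseʳ q) (ℚ.+-monoˡ-≤ (ℚ.- q) h)

p-q≤0⇒p≤q : ∀ {p q} → p ℚ.- q ℚ.≤ 0ℚ → p ℚ.≤ q
p-q≤0⇒p≤q {p} {q} h = 0≤q-p⇒p≤q (subst₂ ℚ._≤_ refl
  (solve 2 (λ p q → :- (p :- q) := q :- p) refl p q) (ℚ.neg-antimono-≤ h))
  where open +-*-Solver

split-sound : ∀ {n} (S : List (Affine (suc n))) {x₀ x} → Sat S (x₀ ∷ x) → Within (split S) x₀ x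
split-sound [] [] = within [] [] []
split-sound ((c , a ∷ as) ∷ S) {x₀} {x} (h ∷ hs) with split S | split-sound S hs | ℚ.<-cmp a 0ℚ
... | bounds _ _ _ | within z l u | tri< a<0 _ _ =
  within z l (p-q≤0⇒p≤q (0≤neg*p⇒p≤0 a {{ℚ.negative a<0}} h′) ∷ u)
  where
  instance
    a≢0 = ℚ.neg⇒nonZero a {{ℚ.negative a<0}}
  h′ = subst (0ℚ ℚ.≤_) (sym (a*[x-solveFor₀] a c as x₀ x)) h
... | bounds _ _ _ | within z l u | tri≈ _ refl _ = within (subst (0ℚ ℚ.≤_) eq h ∷ z) l u
  where
  open +-*-Solver
  eq = solve 3 (λ c x d → c :+ (con 0ℚ :* x :+ d) := c :+ d) refl c x₀ (dot as x)
... | bounds _ _ _ | within z l u | tri> _ _ a>0 =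
  within z (0≤q-p⇒p≤q (0≤pos*p⇒0≤p a {{ℚ.positive a>0}} h′) ∷ l) u
  where
  instance
    a≢0 = ℚ.pos⇒nonZero a {{ℚ.positive a>0}}
  h′ = subst (0ℚ ℚ.≤_) (sym (a*[x-solveFor₀] a c as x₀ x)) h

split-complete : ∀ {n} (S : List (Affine (suc n))) {x₀ x} → Within (split S) x₀ x → Sat S (x₀ ∷ x)
split-complete [] _ = []
split-complete ((c , a ∷ as) ∷ S) {x₀} {x} w with split S | split-complete S {x₀} {x} | ℚ.<-cmp a 0ℚ
split-complete ((c , a ∷ as) ∷ S) {x₀} {x} (within z l (h ∷ u))
  | bounds _ _ _ | ih | tri< a<0 _ _ =
  subst (0ℚ ℚ.≤_) (a*[x-solveFor₀] a c as x₀ x) (nonPos*nonPos⇒0≤ (ℚ.<⇒≤ a<0) (p≤q⇒p-q≤0 h))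
  ∷ ih (within z l u)
  where instance a≢0 = ℚ.neg⇒nonZero a {{ℚ.negative a<0}}
split-complete ((c , a ∷ as) ∷ S) {x₀} {x} (within (h ∷ z) l u)
  | bounds _ _ _ | ih | tri≈ _ refl _ = subst (0ℚ ℚ.≤_) eq h ∷ ih (within z l u)
  where
  open +-*-Solver
  eq = solve 3 (λ c x d → c :+ d := c :+ (con 0ℚ :* x :+ d)) refl c x₀ (dot as x)
split-complete ((c , a ∷ as) ∷ S) {x₀} {x} (within z (h ∷ l) u)
  | bounds _ _ _ | ih | tri> _ _ a>0 =
  subst (0ℚ ℚ.≤_) (a*[x-solveFor₀] a c as x₀ x) (0≤* (ℚ.<⇒≤ a>0) (p≤q⇒0≤q-p h)) ∷ ih (within z l u)
  where instance a≢0 = ℚ.pos⇒nonZero a {{ℚ.positive a>0}}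

-- Fourier–Motzkin elimination of x₀.  The constraint 0 ≤ x₀ contributes the rows `upper`.
eliminate : ∀ {n} → List (Affine (suc n)) → List (Affine n)
eliminate S = free List.++ upper List.++ cartesianProductWith _⊖_ upper lower
  where open Bounds (split S)

eliminate-sound : ∀ {n} (S : List (Affine (suc n))) {x₀ x} →
                  0ℚ ℚ.≤ x₀ → Sat S (x₀ ∷ x) → Sat (eliminate S) x
eliminate-sound S {x₀} {x} 0≤x₀ sat = All.++⁺ free-≥0 (All.++⁺ (All.map (ℚ.≤-trans 0≤x₀) upper-≥)
  (All.cartesianProductWith⁺ (setoid _) (setoid _) _⊖_ upper lower λ {u} {l} u∈ l∈ →
    subst (0ℚ ℚ.≤_) (sym (eval-⊖ u l x))
      (p≤q⇒0≤q-p (ℚ.≤-trans (All.lookup lower-≤ l∈) (All.lookup upper-≥ u∈)))))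
  where
  open Bounds (split S)
  open Within (split-sound S sat)

-- The witness is the greatest lower bound, or 0 if that is larger. The eliminated rows compare each
-- upper bound with 0 and with each lower bound, so this value respects all of them.
eliminate-complete : ∀ {n} (S : List (Affine (suc n))) {x} →
                     Sat (eliminate S) x → ∃ λ x₀ → 0ℚ ℚ.≤ x₀ × Sat S (x₀ ∷ x)
eliminate-complete S {x} sat = x₀ , 0≤maximum ls , split-complete S
  (within (All.++⁻ˡ free sat) (All.map⁻ (≤maximum ls))
    (All.tabulate λ {u} u∈ → maximum≤ (All.lookup (All.++⁻ˡ upper sat′) u∈)
      (All.map⁺ (All.tabulate λ {l} l∈ → 0≤q-p⇒p≤q (subst (0ℚ ℚ.≤_) (eval-⊖ u l x)
        (All.lookup (All.++⁻ʳ upper sat′) (List.∈-cartesianProductWith⁺ _⊖_ u∈ l∈)))))))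
  where
  open Bounds (split S)
  ls = List.map (λ f → eval f x) lower
  x₀ = maximum ls
  sat′ = All.++⁻ʳ free sat

eliminateAll : ∀ k {n} → List (Affine (k ℕ.+ n)) → List (Affine n)
eliminateAll zero    S = S
eliminateAll (suc k) S = eliminateAll k (eliminate S)

eliminateAll-sound : ∀ {k n} (S : List (Affine (k ℕ.+ n))) (x : Vec ℚ k) {y} →
                     NonNeg x → Sat S (x Vec.++ y) → Sat (eliminateAll k S) y
eliminateAll-sound S []       _        sat = sat
eliminateAll-sound S (x₀ ∷ x) (h Vec.∷ hs) sat =
  eliminateAll-sound (eliminate S) x hs (eliminate-sound S h sat)

eliminateAll-complete : ∀ k {n} (S : List (Affine (k ℕ.+ n))) {y} → Sat (eliminateAll k S) y →
                        ∃ λ (x : Vec ℚ k) → NonNeg x × Sat S (x Vec.++ y)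
eliminateAll-complete zero    S sat = [] , Vec.[] , sat
eliminateAll-complete (suc k) S sat =
  let x  , hs , sat′ = eliminateAll-complete k (eliminate S) sat
      x₀ , h , sat″ = eliminate-complete S sat′
  in x₀ ∷ x , h Vec.∷ hs , sat″

Optimal : ∀ {k} → List (Affine (k ℕ.+ 1)) → Vec ℚ k → ℚ → Set
Optimal {k} S x t = Feasible x t × (∀ x′ t′ → Feasible x′ t′ → t ℚ.≤ t′)
  where
  Feasible : Vec ℚ k → ℚ → Set
  Feasible x t = NonNeg x × 0ℚ ℚ.≤ t × Sat S (x Vec.++ (t ∷ []))

-- The objective `t` is the last variable, so eliminating all others leaves a system in `t` alone,
-- and its greatest lower bound `t*` is the least solution. The given feasible `t` shows that `t*`
-- meets the upper bounds, since `t* ≤ t`.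
optimum : ∀ {k} (S : List (Affine (k ℕ.+ 1))) {x t} →
          NonNeg x → 0ℚ ℚ.≤ t → Sat S (x Vec.++ (t ∷ [])) → ∃₂ (Optimal S)
optimum {k} S {x} {t} x≥0 t≥0 sat =
  let x* , x*≥0 , sat* = eliminateAll-complete k S (split-complete S₁ w*)
  in x* , t* , (x*≥0 , 0≤maximum ls , sat*) , λ x′ t′ (x′≥0 , t′≥0 , sat′) →
     maximum≤ t′≥0 (All.map⁺ (lower-≤ (split-sound S₁ (eliminateAll-sound S x′ x′≥0 sat′))))
  where
  open Within
  S₁ = eliminateAll k S
  open Bounds (split S₁)
  ls = List.map (λ f → eval f []) lower
  t* = maximum ls
  w  = split-sound S₁ (eliminateAll-sound S x x≥0 sat)
  t*≤t = maximum≤ t≥0 (All.map⁺ (lower-≤ w))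
  w* : Within (split S₁) t* []
  w* = within (free-≥0 w) (All.map⁻ (≤maximum ls)) (All.map (ℚ.≤-trans t*≤t) (upper-≥ w))

-- Natural numbers as rationals

-- The reduced fraction is written out, so that numerator and denominator compute without a gcd.
ι : ℕ → ℚ
ι k = mkℚ (+ k) 0 (coprime-sym (1-coprimeTo k))

ι-+ : ∀ m n → ι (m ℕ.+ n) ≡ ι m ℚ.+ ι n
ι-+ m n = ℚ.toℚᵘ-injective (ℚᵘ.≃-trans (ℚᵘ.*≡* eq) (ℚᵘ.≃-sym (ℚ.toℚᵘ-homo-+ (ι m) (ι n))))
  where
  eq : + (m ℕ.+ n) ℤ.* + 1 ≡ (+ m ℤ.* + 1 ℤ.+ + n ℤ.* + 1) ℤ.* + 1
  eq = cong (ℤ._* + 1) (cong₂ ℤ._+_ (sym (ℤ.*-identityʳ (+ m))) (sym (ℤ.*-identityʳ (+ n))))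

ι-suc : ∀ k → ι (suc k) ≡ 1ℚ ℚ.+ ι k
ι-suc = ι-+ 1

ι-* : ∀ m n → ι (m ℕ.* n) ≡ ι m ℚ.* ι n
ι-* m n = ℚ.toℚᵘ-injective (ℚᵘ.≃-trans (ℚᵘ.*≡* (cong (ℤ._* + 1) (ℤ.pos-* m n)))
  (ℚᵘ.≃-sym (ℚ.toℚᵘ-homo-* (ι m) (ι n))))

ι-mono-≤ : ∀ {m n} → m ℕ.≤ n → ι m ℚ.≤ ι n
ι-mono-≤ {m} {n} m≤n = ℚ.*≤* (ℤ.*-monoʳ-≤-nonNeg (+ 1) (ℤ.+≤+ m≤n))

ι-cancel-≤ : ∀ {m n} → ι m ℚ.≤ ι n → m ℕ.≤ n
ι-cancel-≤ {m} {n} (ℚ.*≤* h) = ℤ.drop‿+≤+ (ℤ.*-cancelʳ-≤-pos (+ m) (+ n) (+ 1) h)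

ι-cancel-< : ∀ {m n} → ι m ℚ.< ι n → m ℕ.< n
ι-cancel-< h = ℕ.≰⇒> λ n≤m → ℚ.<-irrefl refl (ℚ.<-≤-trans h (ι-mono-≤ n≤m))

0≤ι : ∀ k → 0ℚ ℚ.≤ ι k
0≤ι k = ι-mono-≤ ℕ.z≤n

0<ι : ∀ {k} → 1 ℕ.≤ k → 0ℚ ℚ.< ι k
0<ι h = ℚ.<-≤-trans (ℚ.positive⁻¹ 1ℚ) (ι-mono-≤ h)

mkℚ-*-denominator : ∀ p d-1 .(c : Coprime p (suc d-1)) → mkℚ (+ p) d-1 c ℚ.* ι (suc d-1) ≡ ι p
mkℚ-*-denominator p d-1 c = ℚ.toℚᵘ-injective (ℚᵘ.≃-trans
  (ℚ.toℚᵘ-homo-* (mkℚ (+ p) d-1 c) (ι (suc d-1))) (ℚᵘ.*≡* (ℤ.*-assoc (+ p) (+ suc d-1) (+ 1))))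

-- Sums over subsets

∑ : ∀ {n} → (Subset n → ℚ) → ℚ
∑ {zero}  f = f []
∑ {suc n} f = ∑ (λ A → f (outside ∷ A)) ℚ.+ ∑ (λ A → f (inside ∷ A))

∑-cong : ∀ {n} {f g : Subset n → ℚ} → (∀ A → f A ≡ g A) → ∑ f ≡ ∑ g
∑-cong {zero}  h = h []
∑-cong {suc n} h = cong₂ ℚ._+_ (∑-cong λ A → h (outside ∷ A)) (∑-cong λ A → h (inside ∷ A))

∑-nonNeg : ∀ {n} {f : Subset n → ℚ} → (∀ A → 0ℚ ℚ.≤ f A) → 0ℚ ℚ.≤ ∑ f
∑-nonNeg {zero}  h = h []
∑-nonNeg {suc n} h = ℚ.+-mono-≤ (∑-nonNeg λ A → h (outside ∷ A)) (∑-nonNeg λ A → h (inside ∷ A))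

∑-*ˡ : ∀ {n} k (f : Subset n → ℚ) → ∑ (λ A → k ℚ.* f A) ≡ k ℚ.* ∑ f
∑-*ˡ {zero}  k f = refl
∑-*ˡ {suc n} k f = trans
  (cong₂ ℚ._+_ (∑-*ˡ k (λ A → f (outside ∷ A))) (∑-*ˡ k (λ A → f (inside ∷ A))))
  (sym (ℚ.*-distribˡ-+ k (∑ λ A → f (outside ∷ A)) (∑ λ A → f (inside ∷ A))))

∑-zero : ∀ {n} {f : Subset n → ℚ} → (∀ A → f A ≡ 0ℚ) → ∑ f ≡ 0ℚ
∑-zero {zero}  h = h []
∑-zero {suc n} h = cong₂ ℚ._+_ (∑-zero λ A → h (outside ∷ A)) (∑-zero λ A → h (inside ∷ A))

⟨_,_⟩ : ∀ {n} → (Subset n → ℚ) → (Subset n → ℚ) → ℚ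
⟨ c , q ⟩ = ∑ λ A → c A ℚ.* q A

δ : ∀ {n} → Subset n → Subset n → ℚ
δ []            []            = 1ℚ
δ (outside ∷ B) (outside ∷ A) = δ B A
δ (inside  ∷ B) (inside  ∷ A) = δ B A
δ (outside ∷ B) (inside  ∷ A) = 0ℚ
δ (inside  ∷ B) (outside ∷ A) = 0ℚ

0≤δ : ∀ {n} (B A : Subset n) → 0ℚ ℚ.≤ δ B A
0≤δ []            []            = ℚ.nonNegative⁻¹ 1ℚ
0≤δ (outside ∷ B) (outside ∷ A) = 0≤δ B A
0≤δ (inside  ∷ B) (inside  ∷ A) = 0≤δ B A
0≤δ (outside ∷ B) (inside  ∷ A) = ℚ.≤-refl
0≤δ (inside  ∷ B) (outside ∷ A) = ℚ.≤-refl

⟨δ,⟩ : ∀ {n} (B : Subset n) f → ⟨ δ B , f ⟩ ≡ f B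
⟨δ,⟩ []            f = ℚ.*-identityˡ (f [])
⟨δ,⟩ (outside ∷ B) f = trans (cong₂ ℚ._+_ (⟨δ,⟩ B (λ A → f (outside ∷ A)))
  (∑-zero λ A → ℚ.*-zeroˡ (f (inside ∷ A)))) (ℚ.+-identityʳ _)
⟨δ,⟩ (inside ∷ B)  f = trans (cong₂ ℚ._+_ (∑-zero λ A → ℚ.*-zeroˡ (f (outside ∷ A)))
  (⟨δ,⟩ B (λ A → f (inside ∷ A)))) (ℚ.+-identityˡ _)

⟨,⟩-*ʳ : ∀ {n} (c : Subset n → ℚ) k q → ⟨ c , (λ A → k ℚ.* q A) ⟩ ≡ k ℚ.* ⟨ c , q ⟩
⟨,⟩-*ʳ c k q = trans
  (∑-cong λ A → solve 3 (λ c k q → c :* (k :* q) := k :* (c :* q)) refl (c A) k (q A))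
  (∑-*ˡ k λ A → c A ℚ.* q A)
  where open +-*-Solver

⟨,⟩-*ˡ : ∀ {n} (c : Subset n → ℚ) k q → ⟨ (λ A → k ℚ.* c A) , q ⟩ ≡ k ℚ.* ⟨ c , q ⟩
⟨,⟩-*ˡ c k q = trans (∑-cong λ A → ℚ.*-assoc k (c A) (q A)) (∑-*ˡ k λ A → c A ℚ.* q A)

-- This is `2 ^ n`, by doubling, so that `flatten` can append its two halves without a cast.
size : ℕ → ℕ
size zero    = 1
size (suc n) = size n ℕ.+ size n

flatten : ∀ {n} → (Subset n → ℚ) → Vec ℚ (size n)
flatten {zero}  f = f [] ∷ []
flatten {suc n} f = flatten (λ A → f (outside ∷ A)) Vec.++ flatten (λ A → f (inside ∷ A))

flatten-surjective : ∀ n (v : Vec ℚ (size n)) → ∃ λ (q : Subset n → ℚ) → flatten q ≡ v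
flatten-surjective zero    (x ∷ []) = const x , refl
flatten-surjective (suc n) v with Vec.splitAt (size n) v
... | v₀ , v₁ , refl with flatten-surjective n v₀ | flatten-surjective n v₁
... | q₀ , refl | q₁ , refl = (λ { (outside ∷ A) → q₀ A ; (inside ∷ A) → q₁ A }) , refl

dot-flatten : ∀ {n} (c q : Subset n → ℚ) → dot (flatten c) (flatten q) ≡ ⟨ c , q ⟩
dot-flatten {zero}  c q = ℚ.+-identityʳ _
dot-flatten {suc n} c q = trans (dot-++ (flatten λ A → c (outside ∷ A)) (flatten λ A → q (outside ∷ A)))
  (cong₂ ℚ._+_ (dot-flatten (λ A → c (outside ∷ A)) (λ A → q (outside ∷ A)))
               (dot-flatten (λ A → c (inside ∷ A)) (λ A → q (inside ∷ A))))

flatten-nonNeg⁺ : ∀ {n} {q : Subset n → ℚ} → (∀ A → 0ℚ ℚ.≤ q A) → NonNeg (flatten q)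
flatten-nonNeg⁺ {zero}  h = h [] Vec.∷ Vec.[]
flatten-nonNeg⁺ {suc n} h =
  VecAll.++⁺ (flatten-nonNeg⁺ λ A → h (outside ∷ A)) (flatten-nonNeg⁺ λ A → h (inside ∷ A))

flatten-nonNeg⁻ : ∀ {n} (q : Subset n → ℚ) → NonNeg (flatten q) → ∀ A → 0ℚ ℚ.≤ q A
flatten-nonNeg⁻ {zero}  q (h Vec.∷ Vec.[]) [] = h
flatten-nonNeg⁻ {suc n} q hs (outside ∷ A) =
  flatten-nonNeg⁻ (λ A → q (outside ∷ A)) (VecAll.++ˡ⁻ (flatten λ A → q (outside ∷ A)) hs) A
flatten-nonNeg⁻ {suc n} q hs (inside ∷ A) =
  flatten-nonNeg⁻ (λ A → q (inside ∷ A)) (VecAll.++ʳ⁻ (flatten λ A → q (outside ∷ A)) hs) A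

-- Minimising the largest of finitely many linear forms

-- With `nonNeg`, the field `at-⊥` forces `q ⊥` to be zero; as an inequality it is a single row of
-- the program.
record Weighting {n} (b q : Subset n → ℚ) : Set where
  field
    nonNeg : ∀ A → 0ℚ ℚ.≤ q A
    at-⊥   : q ⊥ ℚ.≤ 0ℚ
    total  : ⟨ b , q ⟩ ≡ 1ℚ

record Solution {n} (b : Subset n → ℚ) (cs : List (Subset n → ℚ)) : Set where
  field
    q         : Subset n → ℚ
    t         : ℚ
    weighting : Weighting b q
    0≤t       : 0ℚ ℚ.≤ t
    bound     : All (λ c → ⟨ c , q ⟩ ℚ.≤ t) cs
    least     : ∀ {q′ t′} → Weighting b q′ → 0ℚ ℚ.≤ t′ → All (λ c → ⟨ c , q′ ⟩ ℚ.≤ t′) cs → t ℚ.≤ t′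

row : ∀ {n} → ℚ → (Subset n → ℚ) → ℚ → Affine (size n ℕ.+ 1)
row k₀ c k = k₀ , flatten c Vec.++ (k ∷ [])

eval-row : ∀ {n} k₀ (c : Subset n → ℚ) k q t →
           eval (row k₀ c k) (flatten q Vec.++ (t ∷ [])) ≡ k₀ ℚ.+ (⟨ c , q ⟩ ℚ.+ k ℚ.* t)
eval-row k₀ c k q t = cong (k₀ ℚ.+_) (trans (dot-++ (flatten c) (flatten q))
  (cong₂ ℚ._+_ (dot-flatten c q) (ℚ.+-identityʳ (k ℚ.* t))))

module MinMax {n} (b : Subset n → ℚ) (cs : List (Subset n → ℚ)) where

  open +-*-Solver

  neg : (Subset n → ℚ) → Subset n → ℚ
  neg c A = (ℚ.- 1ℚ) ℚ.* c A

  -- The equation for the total becomes two opposite rows. The third row is `q ⊥ ≤ 0`, and each form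
  -- `c` contributes `⟨ c , q ⟩ ≤ t`.
  rows : List (Affine (size n ℕ.+ 1))
  rows = row (ℚ.- 1ℚ) b 0ℚ ∷ row 1ℚ (neg b) 0ℚ ∷ row 0ℚ (neg (δ ⊥)) 0ℚ ∷
         List.map (λ c → row 0ℚ (neg c) 1ℚ) cs

  module _ (q : Subset n → ℚ) (t : ℚ) where

    private
      y = flatten q Vec.++ (t ∷ [])

    eval-total-≥ : eval (row (ℚ.- 1ℚ) b 0ℚ) y ≡ ⟨ b , q ⟩ ℚ.- 1ℚ
    eval-total-≥ = trans (eval-row (ℚ.- 1ℚ) b 0ℚ q t)
      (solve 2 (λ B t → con (ℚ.- 1ℚ) :+ (B :+ con 0ℚ :* t) := B :- con 1ℚ) refl ⟨ b , q ⟩ t)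

    eval-total-≤ : eval (row 1ℚ (neg b) 0ℚ) y ≡ 1ℚ ℚ.- ⟨ b , q ⟩
    eval-total-≤ = trans (eval-row 1ℚ (neg b) 0ℚ q t)
      (trans (cong (λ B → 1ℚ ℚ.+ (B ℚ.+ 0ℚ ℚ.* t)) (⟨,⟩-*ˡ b (ℚ.- 1ℚ) q))
        (solve 2 (λ B t → con 1ℚ :+ (con (ℚ.- 1ℚ) :* B :+ con 0ℚ :* t) := con 1ℚ :- B) refl ⟨ b , q ⟩ t))

    eval-⊥ : eval (row 0ℚ (neg (δ ⊥)) 0ℚ) y ≡ 0ℚ ℚ.- q ⊥
    eval-⊥ = trans (eval-row 0ℚ (neg (δ ⊥)) 0ℚ q t)
      (trans (cong (λ B → 0ℚ ℚ.+ (B ℚ.+ 0ℚ ℚ.* t)) (trans (⟨,⟩-*ˡ (δ ⊥) (ℚ.- 1ℚ) q)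
          (cong ((ℚ.- 1ℚ) ℚ.*_) (⟨δ,⟩ ⊥ q))))
        (solve 2 (λ B t → con 0ℚ :+ (con (ℚ.- 1ℚ) :* B :+ con 0ℚ :* t) := con 0ℚ :- B) refl (q ⊥) t))

    eval-bound : ∀ c → eval (row 0ℚ (neg c) 1ℚ) y ≡ t ℚ.- ⟨ c , q ⟩
    eval-bound c = trans (eval-row 0ℚ (neg c) 1ℚ q t)
      (trans (cong (λ B → 0ℚ ℚ.+ (B ℚ.+ 1ℚ ℚ.* t)) (⟨,⟩-*ˡ c (ℚ.- 1ℚ) q))
        (solve 2 (λ B t → con 0ℚ :+ (con (ℚ.- 1ℚ) :* B :+ con 1ℚ :* t) := t :- B) refl ⟨ c , q ⟩ t))

    rows-sat⁺ : Weighting b q → All (λ c → ⟨ c , q ⟩ ℚ.≤ t) cs → Sat rows y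
    rows-sat⁺ w h =
      subst (0ℚ ℚ.≤_) (sym eval-total-≥) (p≤q⇒0≤q-p (ℚ.≤-reflexive (sym total))) ∷
      subst (0ℚ ℚ.≤_) (sym eval-total-≤) (p≤q⇒0≤q-p (ℚ.≤-reflexive total)) ∷
      subst (0ℚ ℚ.≤_) (sym eval-⊥) (p≤q⇒0≤q-p at-⊥) ∷
      All.map⁺ (All.map (λ {c} le → subst (0ℚ ℚ.≤_) (sym (eval-bound c)) (p≤q⇒0≤q-p le)) h)
      where open Weighting w

    rows-sat⁻ : (∀ A → 0ℚ ℚ.≤ q A) → Sat rows y → Weighting b q × All (λ c → ⟨ c , q ⟩ ℚ.≤ t) cs
    rows-sat⁻ q≥0 (h₁ ∷ h₂ ∷ h₃ ∷ hs) = record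
      { nonNeg = q≥0
      ; at-⊥   = 0≤q-p⇒p≤q (subst (0ℚ ℚ.≤_) eval-⊥ h₃)
      ; total  = ℚ.≤-antisym (0≤q-p⇒p≤q (subst (0ℚ ℚ.≤_) eval-total-≤ h₂))
                             (0≤q-p⇒p≤q (subst (0ℚ ℚ.≤_) eval-total-≥ h₁))
      } , All.map (λ {c} h → 0≤q-p⇒p≤q (subst (0ℚ ℚ.≤_) (eval-bound c) h)) (All.map⁻ hs)

  -- Any weighting is feasible once `t` is as large as its greatest value, and `optimum` asks for
  -- nothing more.
  solution : ∀ {q₀} → Weighting b q₀ → Solution b cs
  solution {q₀} w₀ =
    let v , t , (v≥0 , t≥0 , sat) , least = optimum rows {flatten q₀} {t₀}
          (flatten-nonNeg⁺ (Weighting.nonNeg w₀)) (0≤maximum values)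
          (rows-sat⁺ q₀ t₀ w₀ (All.map⁻ (≤maximum values)))
        q , eq = flatten-surjective n v
        q≥0 = flatten-nonNeg⁻ q (subst NonNeg (sym eq) v≥0)
        w , h = rows-sat⁻ q t q≥0 (subst (λ v → Sat rows (v Vec.++ (t ∷ []))) (sym eq) sat)
    in record
    { q = q ; t = t ; weighting = w ; 0≤t = t≥0 ; bound = h
    ; least = λ {q′} {t′} w′ t′≥0 h′ → least (flatten q′) t′
        (flatten-nonNeg⁺ (Weighting.nonNeg w′) , t′≥0 , rows-sat⁺ q′ t′ w′ h′)
    }
    where
    values = List.map (λ c → ⟨ c , q₀ ⟩) cs
    t₀ = maximum values

  -- The minimality of t, made homogeneous in the weighting.
  exceeds : (S : Solution b cs) → ∃ (List._∈ cs) → All (λ c → ∀ A → 0ℚ ℚ.≤ c A) cs →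
            (∀ A → 0ℚ ℚ.≤ b A) →
            ∀ {q r} → (∀ A → 0ℚ ℚ.≤ q A) → q ⊥ ℚ.≤ 0ℚ → r ℚ.< ⟨ b , q ⟩ ℚ.* Solution.t S →
            Any (λ c → r ℚ.< ⟨ c , q ⟩) cs
  exceeds S (c₀ , c₀∈) cs≥0 b≥0 {q} {r} q≥0 q⊥≤0 r<st with Any.any? (λ c → r ℚ.<? ⟨ c , q ⟩) cs
  ... | yes r<some = r<some
  ... | no  ¬r<    = contradiction (ℚ.<-≤-trans r<st st≤r) (ℚ.<-irrefl refl)
    where
    open Solution S using (t; 0≤t; least)
    s = ⟨ b , q ⟩
    ≤r : All (λ c → ⟨ c , q ⟩ ℚ.≤ r) cs
    ≤r = All.map ℚ.≮⇒≥ (All.¬Any⇒All¬ cs ¬r<)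
    -- The form `c₀` has a non-negative value that does not exceed `r`.
    0≤r : 0ℚ ℚ.≤ r
    0≤r = ℚ.≤-trans (∑-nonNeg λ A → 0≤* (All.lookup cs≥0 c₀∈ A) (q≥0 A)) (All.lookup ≤r c₀∈)
    -- If `s` is zero, the left side vanishes. Otherwise `q / s` is a weighting whose values are at
    -- most `r / s`, and the minimality of `t` gives `t ≤ r / s`.
    st≤r : s ℚ.* t ℚ.≤ r
    st≤r with 0ℚ ℚ.<? s
    ... | no ¬s>0 = subst (ℚ._≤ r) (sym (trans (cong (ℚ._* t) s≡0) (ℚ.*-zeroˡ t))) 0≤r
      where
      s≡0 : s ≡ 0ℚ
      s≡0 = ℚ.≤-antisym (ℚ.≮⇒≥ ¬s>0) (∑-nonNeg λ A → 0≤* (b≥0 A) (q≥0 A))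
    ... | yes s>0 = subst (s ℚ.* t ℚ.≤_) (cancel r)
      (ℚ.*-monoˡ-≤-nonNeg s {{ℚ.nonNegative (ℚ.<⇒≤ s>0)}} t≤i*r)
      where
      instance
        s-pos : ℚ.Positive s
        s-pos = ℚ.positive s>0
        s≢0 : ℚ.NonZero s
        s≢0 = ℚ.pos⇒nonZero s
      i = ℚ.1/ s
      0≤i : 0ℚ ℚ.≤ i
      0≤i = ℚ.<⇒≤ (ℚ.positive⁻¹ i {{ℚ.1/pos⇒pos s}})
      cancel : ∀ r → s ℚ.* (i ℚ.* r) ≡ r
      cancel r = trans (sym (ℚ.*-assoc s i r)) (trans (cong (ℚ._* r) (ℚ.*-inverseʳ s)) (ℚ.*-identityˡ r))
      t≤i*r : t ℚ.≤ i ℚ.* r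
      t≤i*r = least {λ A → i ℚ.* q A} (record
        { nonNeg = λ A → 0≤* 0≤i (q≥0 A)
        ; at-⊥   = subst (i ℚ.* q ⊥ ℚ.≤_) (ℚ.*-zeroʳ i) (ℚ.*-monoˡ-≤-nonNeg i {{ℚ.nonNegative 0≤i}} q⊥≤0)
        ; total  = trans (⟨,⟩-*ʳ b i q) (ℚ.*-inverseˡ s)
        }) (0≤* 0≤i 0≤r)
        (All.map (λ {c} h → subst (ℚ._≤ i ℚ.* r) (sym (⟨,⟩-*ʳ c i q))
          (ℚ.*-monoˡ-≤-nonNeg i {{ℚ.nonNegative 0≤i}} h)) ≤r)

-- Comparing lower cuts with rationals

infix 4 _≼_ _≽_

_≼_ _≽_ : ℚ → ℝ → Set
p ≼ x = cut (fromℚ p) ≤ cut x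
p ≽ x = cut x ≤ cut (fromℚ p)

p<q+r⇒p-q<r : ∀ {p q} r → p ℚ.< q ℚ.+ r → p ℚ.- q ℚ.< r
p<q+r⇒p-q<r {p} {q} r h = subst (p ℚ.- q ℚ.<_) (solve 2 (λ q r → q :+ r :- q := r) refl q r)
  (ℚ.+-monoˡ-< (ℚ.- q) h)
  where open +-*-Solver

p-q<r⇒p<q+r : ∀ p q {r} → p ℚ.- q ℚ.< r → p ℚ.< q ℚ.+ r
p-q<r⇒p<q+r p q {r} h = subst (ℚ._< q ℚ.+ r)
  (solve 2 (λ p q → q :+ (p :- q) := p) refl p q) (ℚ.+-monoʳ-< q h)
  where open +-*-Solver

-- The summands must be strictly below `p` and `q`. Density gives `q′` between `r - p` and `q`; this
-- leaves `r - q′ < p`, and density gives `p′` between these two.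
≼-+ : ∀ {p q x y} → p ≼ x → q ≼ y → p ℚ.+ q ≼ x + y
≼-+ {p} {q} p≼x q≼y {r} r<p+q =
  let q′ , r-p<q′ , q′<q = ℚ.<-dense (p<q+r⇒p-q<r q r<p+q)
      p′ , r-q′<p′ , p′<p = ℚ.<-dense (p<q+r⇒p-q<r {r} {q′} p
        (subst (r ℚ.<_) (ℚ.+-comm p q′) (p-q<r⇒p<q+r r p r-p<q′)))
  in p′ , q′ , p≼x p′<p , q≼y q′<q , subst (r ℚ.<_) (ℚ.+-comm q′ p′) (p-q<r⇒p<q+r r q′ r-q′<p′)

≽-+ : ∀ {p q x y} → p ≽ x → q ≽ y → p ℚ.+ q ≽ x + y
≽-+ p≽x q≽y (_ , _ , ∈x , ∈y , r<) = ℚ.<-trans r< (ℚ.+-mono-< (p≽x ∈x) (q≽y ∈y))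

ι-suc-* : ∀ k p → p ℚ.+ ι k ℚ.* p ≡ ι (suc k) ℚ.* p
ι-suc-* k p = sym (trans (cong (ℚ._* p) (ι-suc k))
  (solve 2 (λ i p → (con 1ℚ :+ i) :* p := p :+ i :* p) refl (ι k) p))
  where open +-*-Solver

≼-· : ∀ {p x} → p ≼ x → ∀ k → ι k ℚ.* p ≼ x · k
≼-· {p} p≼x zero    = subst (λ q → q ≼ 0ℝ) (sym (ℚ.*-zeroˡ p)) λ h → h
≼-· {p} {x} p≼x (suc k) =
  subst (λ q → q ≼ x · suc k) (ι-suc-* k p) (≼-+ {p} {ι k ℚ.* p} {x} {x · k} p≼x (≼-· {p} {x} p≼x k))

≽-· : ∀ {p x} → p ≽ x → ∀ k → ι k ℚ.* p ≽ x · k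
≽-· {p} p≽x zero    = subst (λ q → q ≽ 0ℝ) (sym (ℚ.*-zeroˡ p)) λ h → h
≽-· {p} {x} p≽x (suc k) =
  subst (λ q → q ≽ x · suc k) (ι-suc-* k p) (≽-+ {p} {ι k ℚ.* p} {x} {x · k} p≽x (≽-· {p} {x} p≽x k))

≼-∑⊆ : ∀ {n} {q : Subset n → ℚ} {x} → (∀ A → q A ≼ x A) → ∑ q ≼ ∑⊆ x
≼-∑⊆ {zero}  h = h []
≼-∑⊆ {suc n} {q} {x} h =
  ≼-+ {∑ λ A → q (outside ∷ A)} {∑ λ A → q (inside ∷ A)}
      {∑⊆ λ A → x (outside ∷ A)} {∑⊆ λ A → x (inside ∷ A)}
    (≼-∑⊆ {q = λ A → q (outside ∷ A)} {λ A → x (outside ∷ A)} λ A → h (outside ∷ A))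
    (≼-∑⊆ {q = λ A → q (inside ∷ A)} {λ A → x (inside ∷ A)} λ A → h (inside ∷ A))

≽-∑⊆ : ∀ {n} {q : Subset n → ℚ} {x} → (∀ A → q A ≽ x A) → ∑ q ≽ ∑⊆ x
≽-∑⊆ {zero}  h = h []
≽-∑⊆ {suc n} {q} {x} h =
  ≽-+ {∑ λ A → q (outside ∷ A)} {∑ λ A → q (inside ∷ A)}
      {∑⊆ λ A → x (outside ∷ A)} {∑⊆ λ A → x (inside ∷ A)}
    (≽-∑⊆ {q = λ A → q (outside ∷ A)} {λ A → x (outside ∷ A)} λ A → h (outside ∷ A))
    (≽-∑⊆ {q = λ A → q (inside ∷ A)} {λ A → x (inside ∷ A)} λ A → h (inside ∷ A))

≼-∑⊆-· : ∀ {n} (q : Subset n → ℚ) (x : Subset n → ℝ) k → (∀ A → q A ≼ x A) →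
         ⟨ ι ∘ k , q ⟩ ≼ ∑⊆ λ A → x A · k A
≼-∑⊆-· q x k h = ≼-∑⊆ {q = λ A → ι (k A) ℚ.* q A} {λ A → x A · k A}
  λ A → ≼-· {q A} {x A} (h A) (k A)

≽-∑⊆-· : ∀ {n} (q : Subset n → ℚ) (x : Subset n → ℝ) k → (∀ A → q A ≽ x A) →
         ⟨ ι ∘ k , q ⟩ ≽ ∑⊆ λ A → x A · k A
≽-∑⊆-· q x k h = ≽-∑⊆ {q = λ A → ι (k A) ℚ.* q A} {λ A → x A · k A}
  λ A → ≽-· {q A} {x A} (h A) (k A)

≼-⊔ : ∀ {p q} x → p ≼ x → q ≼ x → p ℚ.⊔ q ≼ x
≼-⊔ {p} {q} x p≼x q≼x with ℚ.⊔-sel p q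
... | inj₁ eq = subst (_≼ x) (sym eq) p≼x
... | inj₂ eq = subst (_≼ x) (sym eq) q≼x

Below⇒≼ : ∀ {p} x → Below (cut x) p → p ≼ x
Below⇒≼ x p∈x r<p = down (cut x) r<p p∈x

-- Membership in `x · k` comes with `k` possibly different rationals below `x`; their maximum serves
-- for all copies at once. The conclusion is `p ≼ x` rather than `p` strictly below `x`, because `x`
-- may be zero while `p` must not be negative.
approximate-· : ∀ x → 0ℚ ≼ x → ∀ k {r} → Below (cut (x · k)) r →
                ∃ λ p → 0ℚ ℚ.≤ p × p ≼ x × r ℚ.< ι k ℚ.* p
approximate-· x 0≼x zero    r<0 = 0ℚ , ℚ.≤-refl , 0≼x , r<0
approximate-· x 0≼x (suc k) {r} (p₁ , p₂ , p₁∈x , p₂∈kx , r<p₁+p₂) =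
  let p′ , 0≤p′ , p′≼x , p₂<kp′ = approximate-· x 0≼x k p₂∈kx
      p = p₁ ℚ.⊔ p′
      p≥p′ = ℚ.p≤q⊔p p₁ p′
  in p , ℚ.≤-trans 0≤p′ p≥p′ , ≼-⊔ x (Below⇒≼ x p₁∈x) p′≼x ,
     subst (r ℚ.<_) (ι-suc-* k p) (ℚ.<-≤-trans r<p₁+p₂ (ℚ.+-mono-≤ (ℚ.p≤p⊔q p₁ p′)
       (ℚ.≤-trans (ℚ.<⇒≤ p₂<kp′) (ℚ.*-monoˡ-≤-nonNeg (ι k) p≥p′))))

approximate-∑⊆ : ∀ {n} (x : Subset n → ℝ) → (∀ A → 0ℚ ≼ x A) → ∀ k {r} →
                 Below (cut (∑⊆ λ A → x A · k A)) r →
                 ∃ λ q → (∀ A → 0ℚ ℚ.≤ q A) × (∀ A → q A ≼ x A) × r ℚ.< ⟨ ι ∘ k , q ⟩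
approximate-∑⊆ {zero} x 0≼x k r∈ =
  let p , 0≤p , p≼x , r< = approximate-· (x []) (0≼x []) (k []) r∈
  in const p , (λ _ → 0≤p) , (λ { [] → p≼x }) , r<
approximate-∑⊆ {suc n} x 0≼x k (r₁ , r₂ , r₁∈ , r₂∈ , r<) =
  let q₁ , 0≤q₁ , q₁≼x , r₁< = approximate-∑⊆ (λ A → x (outside ∷ A)) (λ A → 0≼x (outside ∷ A))
                                 (λ A → k (outside ∷ A)) r₁∈
      q₂ , 0≤q₂ , q₂≼x , r₂< = approximate-∑⊆ (λ A → x (inside ∷ A)) (λ A → 0≼x (inside ∷ A))
                                 (λ A → k (inside ∷ A)) r₂∈
  in (λ { (outside ∷ A) → q₁ A ; (inside ∷ A) → q₂ A }) ,
     (λ { (outside ∷ A) → 0≤q₁ A ; (inside ∷ A) → 0≤q₂ A }) ,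
     (λ { (outside ∷ A) → q₁≼x A ; (inside ∷ A) → q₂≼x A }) ,
     ℚ.<-trans r< (ℚ.+-mono-< r₁< r₂<)

Below-max⁺ : ∀ {xs r} → Any (λ x → Below (cut x) r) xs → Below (max xs) r
Below-max⁺ (here h)  = inj₁ h
Below-max⁺ (there h) = inj₂ (Below-max⁺ h)

Below-max⁻ : ∀ xs {r} → Below (max xs) r → Any (λ x → Below (cut x) r) xs
Below-max⁻ (x ∷ xs) (inj₁ h) = here h
Below-max⁻ (x ∷ xs) (inj₂ h) = there (Below-max⁻ xs h)

-- Counting homomorphisms

unique-lookup : ∀ {A : Set} {xs : List A} → Unique xs →
                Injective _≡_ _≡_ (List.lookup xs)
unique-lookup (_  ∷ _) {zero}  {zero}  _  = refl
unique-lookup (x∉ ∷ _) {zero}  {suc j} eq = contradiction eq (All.lookup x∉ (List.∈-lookup j))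
unique-lookup (x∉ ∷ _) {suc i} {zero}  eq = contradiction (sym eq) (All.lookup x∉ (List.∈-lookup i))
unique-lookup (_  ∷ u) {suc i} {suc j} eq = cong suc (unique-lookup u eq)

filter-map : ∀ {A B : Set} {P : Pred B 0ℓ} (P? : Decidable P) (f : A → B) xs →
             filter P? (List.map f xs) ≡ List.map f (filter (P? ∘ f) xs)
filter-map P? f [] = refl
filter-map P? f (x ∷ xs) with Dec.does (P? (f x))
... | true  = cong (f x ∷_) (filter-map P? f xs)
... | false = filter-map P? f xs

length-filter-cartesianProduct :
  ∀ {A B : Set} {P : Pred (A × B) 0ℓ} (P? : Decidable P) xs ys →
  length (filter P? (cartesianProduct xs ys)) ≡
  sum (List.map (λ x → length (filter (λ y → P? (x , y)) ys)) xs)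
length-filter-cartesianProduct P? []       ys = refl
length-filter-cartesianProduct P? (x ∷ xs) ys = begin
  length (filter P? (List.map (x ,_) ys List.++ cartesianProduct xs ys))
    ≡⟨ cong length (List.filter-++ P? (List.map (x ,_) ys) (cartesianProduct xs ys)) ⟩
  length (filter P? (List.map (x ,_) ys) List.++ filter P? (cartesianProduct xs ys))
    ≡⟨ List.length-++ (filter P? (List.map (x ,_) ys)) ⟩
  length (filter P? (List.map (x ,_) ys)) ℕ.+ length (filter P? (cartesianProduct xs ys))
    ≡⟨ cong₂ ℕ._+_ (trans (cong length (filter-map P? (x ,_) ys))
                          (List.length-map (x ,_) (filter (λ y → P? (x , y)) ys)))
         (length-filter-cartesianProduct P? xs ys) ⟩
  _ ∎
  where open ≡-Reasoning

funToFin-cong : ∀ {m n} {f g : Fin m → Fin n} → f ≗ g → funToFin f ≡ funToFin g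
funToFin-cong {zero}  eq = refl
funToFin-cong {suc m} eq = cong₂ combine (eq zero) (funToFin-cong (eq ∘ suc))

funToFin-injective : ∀ {m n} {f g : Fin m → Fin n} → funToFin f ≡ funToFin g → f ≗ g
funToFin-injective {f = f} {g} eq u = begin
  f u                     ≡⟨ Fin.finToFun-funToFin f u ⟨
  finToFun (funToFin f) u ≡⟨ cong (λ k → finToFun k u) eq ⟩
  finToFun (funToFin g) u ≡⟨ Fin.finToFun-funToFin g u ⟩
  g u                     ∎
  where open ≡-Reasoning

finToFun-injective : ∀ m n {i j : Fin (n ℕ.^ m)} → finToFun {n} {m} i ≗ finToFun j → i ≡ j
finToFun-injective m n {i} {j} eq = begin
  i                                  ≡⟨ Fin.funToFin-finToFin {m} {n} i ⟨
  funToFin {m} (finToFun {n} {m} i)  ≡⟨ funToFin-cong {m} {n} eq ⟩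
  funToFin {m} (finToFun {n} {m} j)  ≡⟨ Fin.funToFin-finToFin {m} {n} j ⟩
  j                                  ∎
  where open ≡-Reasoning

module _ (F G : Graph) where

  IsHom-resp : ∀ {φ ψ : V F → V G} → φ ≗ ψ → IsHom F G φ → IsHom F G ψ
  IsHom-resp eq h u v e = subst₂ (Edge G) (eq u) (eq v) (h u v e)

  -- Functions that agree pointwise need not be equal, whereas their codes in `Fin` are, so
  -- homomorphisms are counted by codes.
  homCodes : List (Fin (order G ℕ.^ order F))
  homCodes = filter (λ i → isHom? F G (finToFun i)) (allFin _)

  Hom≡ : Hom F G ≡ List.map finToFun homCodes
  Hom≡ = filter-map (isHom? F G) finToFun (allFin _)

  hom≡ : hom F G ≡ length homCodes
  hom≡ = trans (cong length Hom≡) (List.length-map (finToFun {order G} {order F}) homCodes)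

  funToFin∈homCodes : ∀ {φ} → IsHom F G φ → funToFin φ List.∈ homCodes
  funToFin∈homCodes {φ} h = List.∈-filter⁺ (λ i → isHom? F G (finToFun i)) (List.∈-allFin _)
    (IsHom-resp (sym ∘ Fin.finToFun-funToFin φ) h)

  hom-≥ : ∀ {k} (Φ : Fin k → V F → V G) → (∀ i → IsHom F G (Φ i)) →
          (∀ i j → Φ i ≗ Φ j → i ≡ j) → k ℕ.≤ hom F G
  hom-≥ {k} Φ hom-Φ inj = subst (k ℕ.≤_) (sym hom≡) (Fin.injective⇒≤ {f = position} λ {i} {j} eq →
    inj i j (funToFin-injective (begin
      funToFin (Φ i)                     ≡⟨ Any.lookup-index (member i) ⟩
      List.lookup homCodes (position i)  ≡⟨ cong (List.lookup homCodes) eq ⟩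
      List.lookup homCodes (position j)  ≡⟨ Any.lookup-index (member j) ⟨
      funToFin (Φ j)                     ∎)))
    where
    open ≡-Reasoning
    member : ∀ i → funToFin (Φ i) List.∈ homCodes
    member i = funToFin∈homCodes (hom-Φ i)
    position : Fin k → Fin (length homCodes)
    position i = index (member i)

  hom-≤ : ∀ {k} (code : ∀ φ → IsHom F G φ → Fin k) →
          (∀ {φ ψ} (hφ : IsHom F G φ) (hψ : IsHom F G ψ) → code φ hφ ≡ code ψ hψ → φ ≗ ψ) →
          hom F G ℕ.≤ k
  hom-≤ {k} code inj = subst (ℕ._≤ k) (sym hom≡) (Fin.injective⇒≤ {f = λ i → code (φ i) (isHom i)}
    λ {i} {j} eq → unique-lookup
      (Unique.filter⁺ (λ i → isHom? F G (finToFun {order G} {order F} i)) (Unique.allFin⁺ _))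
      (finToFun-injective (order F) (order G) (inj (isHom i) (isHom j) eq)))
    where
    φ : Fin (length homCodes) → V F → V G
    φ i = finToFun (List.lookup homCodes i)
    isHom : ∀ i → IsHom F G (φ i)
    isHom i = proj₂ (List.∈-filter⁻ (λ i → isHom? F G (finToFun i)) {xs = allFin _} (List.∈-lookup i))

  Hom-complete : ∀ {φ} → IsHom F G φ → ∃ λ i → List.lookup (Hom F G) i ≗ φ
  Hom-complete {φ} h = index φ′∈ , λ u → trans (cong (λ ψ → ψ u) (sym (Any.lookup-index φ′∈)))
                                               (Fin.finToFun-funToFin φ u)
    where
    φ′∈ : finToFun (funToFin φ) List.∈ Hom F G
    φ′∈ = List.∈-filter⁺ (isHom? F G) (List.∈-map⁺ finToFun (List.∈-allFin (funToFin φ)))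
      (IsHom-resp (sym ∘ Fin.finToFun-funToFin φ) h)

-- Connected components and their least vertices

least : ∀ {n} {P : Pred (Fin n) 0ℓ} → Decidable P → ∃ P → ∃ λ i → P i × (∀ j → P j → i Fin.≤ j)
least {suc n} P? (i , Pi) with P? zero
... | yes P0 = zero , P0 , λ _ _ → ℕ.z≤n
least {suc n} P? (zero  , P0) | no ¬P0 = contradiction P0 ¬P0
least {suc n} P? (suc i , Pi) | no ¬P0 with j , Pj , j≤ ← least (P? ∘ suc) (i , Pi) =
  suc j , Pj , λ { zero P0 → contradiction P0 ¬P0 ; (suc k) Pk → ℕ.s≤s (j≤ k Pk) }

module _ (H : Graph) (A : Subset (order H)) where

  private
    R = InducedEdge H A

    connected-sym : ∀ {u v} → Connected H A u v → Connected H A v u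
    connected-sym = EqClosure.symmetric R

    connected-trans : ∀ {u v w} → Connected H A u v → Connected H A v w → Connected H A u w
    connected-trans = EqClosure.transitive R

    leastConnected : ∀ v → ∃ λ w → Connected H A v w × (∀ x → Connected H A v x → w Fin.≤ x)
    leastConnected v = least (connected? H A v) (v , EqClosure.reflexive R)

  root : V H → V H
  root v = proj₁ (leastConnected v)

  connected-root : ∀ v → Connected H A v (root v)
  connected-root v = proj₁ (proj₂ (leastConnected v))

  root-≤ : ∀ {v w} → Connected H A v w → root v Fin.≤ w
  root-≤ {v} c = proj₂ (proj₂ (leastConnected v)) _ c

  root-cong : ∀ {u v} → Connected H A u v → root u ≡ root v
  root-cong c = Fin.≤-antisym
    (root-≤ (connected-trans c (connected-root _)))
    (root-≤ (connected-trans (connected-sym c) (connected-root _)))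

  -- Proved in both directions at once, since folding over the closure needs a symmetric relation.
  connected-∈ : ∀ {u v} → Connected H A u v → u ∈ A → v ∈ A
  connected-∈ c = proj₁ (EqClosure.fold {S = λ u v → (u ∈ A → v ∈ A) × (v ∈ A → u ∈ A)}
    (record { refl = (λ p → p) , (λ p → p) ; sym = λ (f , g) → g , f
            ; trans = λ (f , g) (h , k) → h ∘ f , g ∘ k })
    (λ (u∈ , v∈ , _) → const v∈ , const u∈) c)

  root-isRepresentative : ∀ {v} → v ∈ A → IsRepresentative H A (root v)
  root-isRepresentative {v} v∈ = connected-∈ (connected-root v) v∈ ,
    λ w c → root-≤ (connected-trans (connected-root v) c)

  root-representative : ∀ {v} → IsRepresentative H A v → root v ≡ v
  root-representative {v} (_ , v≤) = Fin.≤-antisym (root-≤ (EqClosure.reflexive R)) (v≤ _ (connected-root v))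

-- The components of all H|B j, indexed by one Fin so that colourings of them can be counted.
module Components (H : Graph) {W} (B : Fin W → Subset (order H)) where

  private
    isRep? = λ ((j , v) : Fin W × V H) → isRepresentative? H (B j) v

  components : List (Fin W × V H)
  components = filter isRep? (cartesianProduct (allFin W) (allFin (order H)))

  length-components : length components ≡ sum (List.map (λ j → CC H (B j)) (allFin W))
  length-components = length-filter-cartesianProduct isRep? (allFin W) (allFin (order H))

  private
    root∈ : ∀ {j v} → v ∈ B j → (j , root H (B j) v) List.∈ components
    root∈ {j} {v} v∈ = List.∈-filter⁺ isRep?
      (List.∈-cartesianProduct⁺ (List.∈-allFin j) (List.∈-allFin _)) (root-isRepresentative H (B j) v∈)

  component : ∀ {j v} → v ∈ B j → Fin (length components)
  component v∈ = index (root∈ v∈)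

  lookup-component : ∀ {j v} (v∈ : v ∈ B j) → List.lookup components (component v∈) ≡ (j , root H (B j) v)
  lookup-component v∈ = sym (Any.lookup-index (root∈ v∈))

  component-cong : ∀ {j u v} (u∈ : u ∈ B j) (v∈ : v ∈ B j) → Connected H (B j) u v →
                   component u∈ ≡ component v∈
  component-cong {j} u∈ v∈ c = unique-lookup
    (Unique.filter⁺ isRep? (Unique.cartesianProduct⁺ (Unique.allFin⁺ W) (Unique.allFin⁺ _)))
    (trans (lookup-component u∈) (trans (cong (j ,_) (root-cong H (B j) c)) (sym (lookup-component v∈))))

  lookup-isRepresentative : ∀ i → let j , v = List.lookup components i in IsRepresentative H (B j) v
  lookup-isRepresentative i = proj₂ (List.∈-filter⁻ isRep?
    {xs = cartesianProduct (allFin W) (allFin (order H))} (List.∈-lookup i))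

  component-surjective : ∀ i → ∃₂ λ j v → ∃ λ (v∈ : v ∈ B j) → component v∈ ≡ i
  component-surjective i = _ , _ , proj₁ rep , unique-lookup
    (Unique.filter⁺ isRep? (Unique.cartesianProduct⁺ (Unique.allFin⁺ W) (Unique.allFin⁺ _)))
    (trans (lookup-component (proj₁ rep))
      (cong (proj₁ (List.lookup components i) ,_) (root-representative H (B _) rep)))
    where rep = lookup-isRepresentative i

-- The coloured blow-up and its homomorphism counts

∈-preimage⁺ : ∀ {m n} (φ : Fin m → Fin n) {A v} → φ v ∈ A → v ∈ preimage φ A
∈-preimage⁺ φ {A} {v} φv∈ = Vec.lookup⇒[]= v _
  (trans (Vec.lookup∘tabulate (Vec.lookup A ∘ φ) v) (Vec.[]=⇒lookup φv∈))

∈-preimage⁻ : ∀ {m n} (φ : Fin m → Fin n) {A v} → v ∈ preimage φ A → φ v ∈ A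
∈-preimage⁻ φ {A} {v} v∈ = Vec.lookup⇒[]= (φ v) A
  (trans (sym (Vec.lookup∘tabulate (Vec.lookup A ∘ φ) v)) (Vec.[]=⇒lookup v∈))

-- A vertex over v carries one of N colours for each slot containing v.  For the other slots the
-- colour is forced to be zero, so that isolated vertices are not counted with extra freedom.
module BlowUp (G : Graph) (slots : List (Subset (order G))) (N-1 : ℕ) where

  N W : ℕ
  N = suc N-1
  W = length slots

  slot : Fin W → Subset (order G)
  slot = List.lookup slots

  Colouring : Set
  Colouring = Fin W → Fin N

  Supported : V G → Colouring → Set
  Supported v f = ∀ j → v ∉ slot j → f j ≡ zero

  private
    Code : Set
    Code = Fin (order G ℕ.* N ℕ.^ W)

    codeBase : Code → V G
    codeBase = quotient {order G} (N ℕ.^ W)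

    codeColour : Code → Colouring
    codeColour c = finToFun {N} {W} (remainder {order G} (N ℕ.^ W) c)

    supported? : ∀ c → Dec (Supported (codeBase c) (codeColour c))
    supported? c = Fin.all? λ j → ¬? (codeBase c ∈? slot j) →-dec (codeColour c j Fin.≟ zero)

    codes : List Code
    codes = filter supported? (allFin _)

    encode : V G → Colouring → Code
    encode v f = combine v (funToFin f)

    codeBase-encode : ∀ v f → codeBase (encode v f) ≡ v
    codeBase-encode v f = cong proj₁ (Fin.remQuot-combine {order G} {N ℕ.^ W} v (funToFin f))

    codeColour-encode : ∀ v f → codeColour (encode v f) ≗ f
    codeColour-encode v f j = trans
      (cong (λ c → finToFun {N} {W} (proj₂ c) j) (Fin.remQuot-combine {order G} {N ℕ.^ W} v (funToFin f)))
      (Fin.finToFun-funToFin f j)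

    encode∈codes : ∀ v f → Supported v f → encode v f List.∈ codes
    encode∈codes v f s = List.∈-filter⁺ supported? (List.∈-allFin _) λ j v∉ →
      trans (codeColour-encode v f j) (s j (v∉ ∘ subst (_∈ slot j) (sym (codeBase-encode v f))))

    code-ext : ∀ {c d} → codeBase c ≡ codeBase d → codeColour c ≗ codeColour d → c ≡ d
    code-ext {c} {d} b≡ f≗ = begin
      c                                                       ≡⟨ Fin.combine-remQuot {order G} (N ℕ.^ W) c ⟨
      combine (codeBase c) (remainder {order G} (N ℕ.^ W) c)  ≡⟨ cong₂ combine b≡ (finToFun-injective W N f≗) ⟩
      combine (codeBase d) (remainder {order G} (N ℕ.^ W) d)  ≡⟨ Fin.combine-remQuot {order G} (N ℕ.^ W) d ⟩
      d                                                       ∎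
      where open ≡-Reasoning

  base : Fin (length codes) → V G
  base = codeBase ∘ List.lookup codes

  colour : Fin (length codes) → Colouring
  colour = codeColour ∘ List.lookup codes

  Agree : Fin (length codes) → Fin (length codes) → Set
  Agree s t = ∀ j → base s ∈ slot j → base t ∈ slot j → colour s j ≡ colour t j

  edge? : ∀ s t → Dec (Edge G (base s) (base t) × Agree s t)
  edge? s t = T? (edge G (base s) (base t)) ×-dec
    Fin.all? λ j → (base s ∈? slot j) →-dec (base t ∈? slot j) →-dec (colour s j Fin.≟ colour t j)

  blowUp : Graph
  blowUp = record
    { order    = length codes
    -- The all-zero colouring is supported at every vertex.
    ; nonempty = Fin.nonZeroIndex (index (encode∈codes (someVertex G) (const zero) λ _ _ → refl))
    ; edge     = λ s t → ⌊ edge? s t ⌋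
    }
    where
    someVertex : ∀ G → V G
    someVertex record { order = suc _ } = zero

  vertex : ∀ v f → Supported v f → V blowUp
  vertex v f s = index (encode∈codes v f s)

  base-vertex : ∀ v f (s : Supported v f) → base (vertex v f s) ≡ v
  base-vertex v f s = trans (cong codeBase (sym (Any.lookup-index (encode∈codes v f s))))
    (codeBase-encode v f)

  colour-vertex : ∀ v f (s : Supported v f) → colour (vertex v f s) ≗ f
  colour-vertex v f s j = trans (cong (λ c → codeColour c j) (sym (Any.lookup-index (encode∈codes v f s))))
    (codeColour-encode v f j)

  colour-outside : ∀ t → Supported (base t) (colour t)
  colour-outside t = proj₂ (List.∈-filter⁻ supported? {xs = allFin _} (List.∈-lookup t))

  vertex-ext : ∀ {s t} → base s ≡ base t → colour s ≗ colour t → s ≡ t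
  vertex-ext b≡ f≗ = unique-lookup (Unique.filter⁺ supported? (Unique.allFin⁺ _)) (code-ext b≡ f≗)

  module _ where

    open Components G slot

    private
      k = length components

      component′ : (Fin k → Fin N) → ∀ v j → Dec (v ∈ slot j) → Fin N
      component′ x v j (yes v∈) = x (component v∈)
      component′ x v j (no _)   = zero

      colouring : (Fin k → Fin N) → V G → Colouring
      colouring x v j = component′ x v j (v ∈? slot j)

      colouring-component : ∀ x {v j} (v∈ : v ∈ slot j) → colouring x v j ≡ x (component v∈)
      colouring-component x {v} {j} v∈ with v ∈? slot j
      -- Reflexivity of connectedness shows that `component` does not depend on the proof of
      -- membership.
      ... | yes v∈′ = cong x (component-cong v∈′ v∈ (EqClosure.reflexive _))
      ... | no  v∉  = contradiction v∈ v∉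

      colouring-supported : ∀ x v → Supported v (colouring x v)
      colouring-supported x v j v∉ with v ∈? slot j
      ... | yes v∈ = contradiction v∈ v∉
      ... | no  _  = refl

      -- A section of `base`: a choice `x` of one colour per component gives a homomorphism over the
      -- identity of `G`, since both ends of an edge inside a slot lie in the same component.
      lift : (Fin k → Fin N) → V G → V blowUp
      lift x v = vertex v (colouring x v) (colouring-supported x v)

      base-lift : ∀ x v → base (lift x v) ≡ v
      base-lift x v = base-vertex v (colouring x v) (colouring-supported x v)

      colour-lift : ∀ x v {j} (v∈ : v ∈ slot j) → colour (lift x v) j ≡ x (component v∈)
      colour-lift x v {j} v∈ = trans (colour-vertex v (colouring x v) (colouring-supported x v) j)
        (colouring-component x v∈)

      lift-isHom : ∀ x → IsHom G blowUp (lift x)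
      lift-isHom x u v e = fromWitness {a? = edge? (lift x u) (lift x v)}
        ( subst₂ (Edge G) (sym (base-lift x u)) (sym (base-lift x v)) e
        , λ j u∈′ v∈′ →
            let u∈ = subst (_∈ slot j) (base-lift x u) u∈′
                v∈ = subst (_∈ slot j) (base-lift x v) v∈′
            in trans (colour-lift x u u∈) (trans
                 (cong x (component-cong u∈ v∈ (EqClosure.return (u∈ , v∈ , e))))
                 (sym (colour-lift x v v∈))))

      -- Each component contains a vertex, and the colour chosen for the component can be read off
      -- there.
      lift-injective : ∀ x y → lift x ≗ lift y → x ≗ y
      lift-injective x y eq i =
        let j , v , v∈ , c≡i = component-surjective i
        in subst (λ i → x i ≡ y i) c≡i
             (trans (sym (colour-lift x v v∈)) (trans (cong (λ t → colour t j) (eq v))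
               (colour-lift y v v∈)))

    hom-blowUp-≥ : N ℕ.^ sum (List.map (CC G) slots) ℕ.≤ hom G blowUp
    hom-blowUp-≥ = subst (λ k → N ℕ.^ k ℕ.≤ hom G blowUp) k≡
      (hom-≥ G blowUp (λ i → lift (finToFun {N} {k} i)) (λ i → lift-isHom (finToFun {N} {k} i))
        λ i j eq → finToFun-injective k N (lift-injective (finToFun {N} {k} i) (finToFun {N} {k} j) eq))
      where
      k≡ : k ≡ sum (List.map (CC G) slots)
      k≡ = trans length-components (cong sum (trans (List.map-tabulate (λ j → j) (CC G ∘ slot))
        (trans (sym (List.map-tabulate slot (CC G))) (cong (List.map (CC G)) (List.tabulate-lookup slots)))))

  module _ (F : Graph) (E : ℕ)
           (bound : ∀ {φ} → φ List.∈ Hom F G → sum (List.map (CC F ∘ preimage φ) slots) ℕ.≤ E) where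

    private
      h = hom F G

      shadow : Fin h → V F → V G
      shadow = List.lookup (Hom F G)

      part : Fin h → Fin W → Subset (order F)
      part i j = preimage (shadow i) (slot j)

      comps : Fin h → List (Fin W × V F)
      comps i = Components.components F (part i)

      length-comps-≤ : ∀ i → length (comps i) ℕ.≤ E
      length-comps-≤ i = ℕ.≤-trans (ℕ.≤-reflexive eq) (bound (List.∈-lookup i))
        where
        cc = CC F ∘ preimage (shadow i)
        eq : length (comps i) ≡ sum (List.map cc slots)
        eq = trans (Components.length-components F (part i))
          (cong sum (trans (List.map-tabulate (λ j → j) (cc ∘ slot))
            (trans (sym (List.map-tabulate slot cc)) (cong (List.map cc) (List.tabulate-lookup slots)))))

      base-isHom : ∀ {ψ} → IsHom F blowUp ψ → IsHom F G (base ∘ ψ)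
      base-isHom {ψ} hψ u v e = proj₁ (toWitness {a? = edge? (ψ u) (ψ v)} (hψ u v e))

      -- The projection `base ∘ ψ` agrees only pointwise with a listed map. Working with the
      -- position `i` of that map fixes one family of parts for all `ψ` over it, and the hypothesis
      -- `bound` applies to it.
      shadow-of : ∀ {ψ} → IsHom F blowUp ψ → ∃ λ i → shadow i ≗ base ∘ ψ
      shadow-of hψ = Hom-complete F G (base-isHom hψ)

      colour-connected : ∀ {ψ} → IsHom F blowUp ψ → ∀ i → shadow i ≗ base ∘ ψ → ∀ j {u v} →
                         Connected F (part i j) u v → colour (ψ u) j ≡ colour (ψ v) j
      colour-connected {ψ} hψ i b≗ j = EqClosure.gfold isEquivalence (λ u → colour (ψ u) j)
        λ {u} {v} (u∈ , v∈ , e) →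
        proj₂ (toWitness {a? = edge? (ψ u) (ψ v)} (hψ u v e)) j (inSlot u∈) (inSlot v∈)
        where
        inSlot : ∀ {u} → u ∈ part i j → base (ψ u) ∈ slot j
        inSlot {u} u∈ = subst (_∈ slot j) (b≗ u) (∈-preimage⁻ (shadow i) u∈)

      componentColours : ∀ i → (V F → V blowUp) → Fin (length (comps i)) → Fin N
      componentColours i ψ e = let j , r = List.lookup (comps i) e in colour (ψ r) j

      -- Over a slot, the colour of a vertex equals that of the root of its component, which is
      -- recorded; off the slot it is forced to be zero.
      componentColours-injective : ∀ {φ ψ} → IsHom F blowUp φ → IsHom F blowUp ψ → ∀ i →
        shadow i ≗ base ∘ φ → shadow i ≗ base ∘ ψ →
        componentColours i φ ≗ componentColours i ψ → φ ≗ ψ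
      componentColours-injective {φ} {ψ} hφ hψ i bφ bψ eq u =
        vertex-ext (trans (sym (bφ u)) (bψ u)) colours≗
        where
        open Components F (part i)
        open ≡-Reasoning
        colours≗ : colour (φ u) ≗ colour (ψ u)
        colours≗ j with shadow i u ∈? slot j
        ... | no u∉ = trans (colour-outside (φ u) j (u∉ ∘ subst (_∈ slot j) (sym (bφ u))))
                       (sym (colour-outside (ψ u) j (u∉ ∘ subst (_∈ slot j) (sym (bψ u)))))
        ... | yes u∈′ = begin
          colour (φ u) j                     ≡⟨ colour-connected hφ i bφ j (connected-root F (part i j) u) ⟩
          colour (φ r) j                     ≡⟨ cong (λ (j , r) → colour (φ r) j) (lookup-component u∈) ⟨
          componentColours i φ (component u∈) ≡⟨ eq (component u∈) ⟩
          componentColours i ψ (component u∈) ≡⟨ cong (λ (j , r) → colour (ψ r) j) (lookup-component u∈) ⟩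
          colour (ψ r) j                     ≡⟨ colour-connected hψ i bψ j (connected-root F (part i j) u) ⟨
          colour (ψ u) j                     ∎
          where
          u∈ = ∈-preimage⁺ (shadow i) u∈′
          r = root F (part i j) u

      -- The number of components varies with the shadow; embedding into the common size `N ^ E`
      -- lets all codes live in one `Fin`.
      padded : ∀ i → (Fin (length (comps i)) → Fin N) → Fin (N ℕ.^ E)
      padded i y = inject≤ (funToFin y) (ℕ.^-monoʳ-≤ N (length-comps-≤ i))

      Shadow : (V F → V blowUp) → Set
      Shadow ψ = ∃ λ i → shadow i ≗ base ∘ ψ

      code : ∀ ψ → Shadow ψ → Fin (h ℕ.* N ℕ.^ E)
      code ψ (i , _) = combine i (padded i (componentColours i ψ))

      padded-injective : ∀ {i} {x y : Fin (length (comps i)) → Fin N} → padded i x ≡ padded i y → x ≗ y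
      padded-injective {i} {x} {y} eq = funToFin-injective
        (Fin.inject≤-injective le le (funToFin x) (funToFin y) eq)
        where le = ℕ.^-monoʳ-≤ N (length-comps-≤ i)

      code-injective : ∀ {φ ψ} → IsHom F blowUp φ → IsHom F blowUp ψ → (S : Shadow φ) (S′ : Shadow ψ) →
                       code φ S ≡ code ψ S′ → φ ≗ ψ
      code-injective {φ} {ψ} hφ hψ (i , bφ) (i′ , bψ) eq =
        same (Fin.combine-injectiveˡ i (padded i _) i′ (padded i′ _) eq) bψ
             (Fin.combine-injectiveʳ i (padded i _) i′ (padded i′ _) eq)
        where
        -- The padded colours have types depending on the shadow, so `i′` is generalised before the
        -- two shadows are identified.
        same : ∀ {i′} → i ≡ i′ → shadow i′ ≗ base ∘ ψ →
               padded i (componentColours i φ) ≡ padded i′ (componentColours i′ ψ) → φ ≗ ψ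
        same refl bψ eq = componentColours-injective hφ hψ i bφ bψ (padded-injective eq)

    hom-blowUp-≤ : hom F blowUp ℕ.≤ hom F G ℕ.* N ℕ.^ E
    hom-blowUp-≤ = hom-≤ F blowUp (λ ψ hψ → code ψ (shadow-of hψ))
      λ hφ hψ → code-injective hφ hψ (shadow-of hφ) (shadow-of hψ)

-- The blow-up and the growth rate

-- The multiset of subsets with multiplicities `w`, so that an integral weight becomes that many
-- independent colours.
slotsOf : ∀ {n} → (Subset n → ℕ) → List (Subset n)
slotsOf {zero}  w = List.replicate (w []) []
slotsOf {suc n} w = List.map (outside ∷_) (slotsOf λ A → w (outside ∷ A)) List.++
                    List.map (inside ∷_) (slotsOf λ A → w (inside ∷ A))

ι-sum-slotsOf : ∀ {n} (g w : Subset n → ℕ) →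
                ι (sum (List.map g (slotsOf w))) ≡ ⟨ ι ∘ g , ι ∘ w ⟩
ι-sum-slotsOf {zero} g w = go (w [])
  where
  go : ∀ k → ι (sum (List.map g (List.replicate k []))) ≡ ι (g []) ℚ.* ι k
  go zero    = sym (ℚ.*-zeroʳ (ι (g [])))
  go (suc k) = begin
    ι (g [] ℕ.+ sum (List.map g (List.replicate k [])))      ≡⟨ ι-+ (g []) _ ⟩
    ι (g []) ℚ.+ ι (sum (List.map g (List.replicate k [])))  ≡⟨ cong (ι (g []) ℚ.+_) (go k) ⟩
    ι (g []) ℚ.+ ι (g []) ℚ.* ι k
      ≡⟨ solve 2 (λ a b → a :+ a :* b := a :* (con 1ℚ :+ b)) refl (ι (g [])) (ι k) ⟩
    ι (g []) ℚ.* (1ℚ ℚ.+ ι k)                                ≡⟨ cong (ι (g []) ℚ.*_) (ι-suc k) ⟨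
    ι (g []) ℚ.* ι (suc k)                                   ∎
    where
    open ≡-Reasoning
    open +-*-Solver
ι-sum-slotsOf {suc n} g w = begin
  ι (sum (List.map g (os List.++ is)))
    ≡⟨ cong (ι ∘ sum) (List.map-++ g os is) ⟩
  ι (sum (List.map g os List.++ List.map g is))
    ≡⟨ cong ι (sum-++ (List.map g os) (List.map g is)) ⟩
  ι (sum (List.map g os) ℕ.+ sum (List.map g is))
    ≡⟨ ι-+ (sum (List.map g os)) (sum (List.map g is)) ⟩
  ι (sum (List.map g os)) ℚ.+ ι (sum (List.map g is))
    ≡⟨ cong₂ ℚ._+_ (half outside) (half inside) ⟩
  ⟨ ι ∘ g , ι ∘ w ⟩
    ∎
  where
  open ≡-Reasoning
  side = λ s → slotsOf λ A → w (s ∷ A)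
  os = List.map (outside ∷_) (side outside)
  is = List.map (inside ∷_) (side inside)
  half : ∀ s → ι (sum (List.map g (List.map (s ∷_) (side s)))) ≡
         ⟨ (λ A → ι (g (s ∷ A))) , (λ A → ι (w (s ∷ A))) ⟩
  half s = trans (cong (ι ∘ sum) (sym (List.map-∘ (side s))))
    (ι-sum-slotsOf (λ A → g (s ∷ A)) (λ A → w (s ∷ A)))

commonDenominator : ∀ {n} (q : Subset n → ℚ) → (∀ A → 0ℚ ℚ.≤ q A) →
  ∃₂ λ D (w : Subset _ → ℕ) → 1 ℕ.≤ D × (∀ A → ι (w A) ≡ ι D ℚ.* q A)
commonDenominator {zero} q q≥0 with q [] in eq | q≥0 []
... | mkℚ (+ p) d-1 c | _ = suc d-1 , const p , ℕ.s≤s ℕ.z≤n , λ { [] → begin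
  ι p                                   ≡⟨ mkℚ-*-denominator p d-1 c ⟨
  mkℚ (+ p) d-1 c ℚ.* ι (suc d-1)       ≡⟨ ℚ.*-comm (mkℚ (+ p) d-1 c) (ι (suc d-1)) ⟩
  ι (suc d-1) ℚ.* mkℚ (+ p) d-1 c       ≡⟨ cong (ι (suc d-1) ℚ.*_) eq ⟨
  ι (suc d-1) ℚ.* q []                  ∎ }
  where open ≡-Reasoning
... | mkℚ -[1+ _ ] _ _ | ℚ.*≤* ()
commonDenominator {suc n} q q≥0 =
  let D₀ , w₀ , D₀≥1 , eq₀ = commonDenominator (λ A → q (outside ∷ A)) (λ A → q≥0 (outside ∷ A))
      D₁ , w₁ , D₁≥1 , eq₁ = commonDenominator (λ A → q (inside ∷ A)) (λ A → q≥0 (inside ∷ A))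
  in D₀ ℕ.* D₁ , (λ { (outside ∷ A) → D₁ ℕ.* w₀ A ; (inside ∷ A) → D₀ ℕ.* w₁ A }) ,
     ℕ.*-mono-≤ D₀≥1 D₁≥1 ,
     λ { (outside ∷ A) → trans (scaled D₁ D₀ (w₀ A) (q (outside ∷ A)) (eq₀ A))
           (cong (λ k → ι k ℚ.* q (outside ∷ A)) (ℕ.*-comm D₁ D₀))
       ; (inside ∷ A) → scaled D₀ D₁ (w₁ A) (q (inside ∷ A)) (eq₁ A) }
  where
  scaled : ∀ k D w p → ι w ≡ ι D ℚ.* p → ι (k ℕ.* w) ≡ ι (k ℕ.* D) ℚ.* p
  scaled k D w p eq = begin
    ι (k ℕ.* w)             ≡⟨ ι-* k w ⟩
    ι k ℚ.* ι w             ≡⟨ cong (ι k ℚ.*_) eq ⟩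
    ι k ℚ.* (ι D ℚ.* p)     ≡⟨ ℚ.*-assoc (ι k) (ι D) p ⟨
    ι k ℚ.* ι D ℚ.* p       ≡⟨ cong (ℚ._* p) (ι-* k D) ⟨
    ι (k ℕ.* D) ℚ.* p       ∎
    where open ≡-Reasoning

*-^ : ∀ m n k → (m ℕ.* n) ℕ.^ k ≡ m ℕ.^ k ℕ.* n ℕ.^ k
*-^ m n zero    = refl
*-^ m n (suc k) = trans (cong (m ℕ.* n ℕ.*_) (*-^ m n k))
  (interchange ℕ.*-commutativeSemigroup m n (m ℕ.^ k) (n ℕ.^ k))

-- If `b d < a`, cancelling `N ^ (b d)` from the growth condition leaves `N ≤ h ^ d`. The choice
-- `N = h ^ d + 1` refutes this.
exponent-≤ : ∀ a b h d → (∀ N-1 → suc N-1 ℕ.^ a ℕ.≤ (h ℕ.* suc N-1 ℕ.^ b) ℕ.^ d) → a ℕ.≤ b ℕ.* d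
exponent-≤ a b h d growth = ℕ.≮⇒≥ λ bd<a → ℕ.<-irrefl refl
  (ℕ.*-cancelʳ-≤ N (h ℕ.^ d) (N ℕ.^ (b ℕ.* d)) {{ℕ.m^n≢0 N (b ℕ.* d)}} (begin
    N ℕ.^ suc (b ℕ.* d)               ≤⟨ ℕ.^-monoʳ-≤ N bd<a ⟩
    N ℕ.^ a                           ≤⟨ growth (h ℕ.^ d) ⟩
    (h ℕ.* N ℕ.^ b) ℕ.^ d             ≡⟨ *-^ h (N ℕ.^ b) d ⟩
    h ℕ.^ d ℕ.* (N ℕ.^ b) ℕ.^ d       ≡⟨ cong (h ℕ.^ d ℕ.*_) (ℕ.^-*-assoc N b d) ⟩
    h ℕ.^ d ℕ.* N ℕ.^ (b ℕ.* d)       ∎))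
  where
  open ℕ.≤-Reasoning
  N = suc (h ℕ.^ d)

-- The program of two graphs, its optimality among real weightings, and the exponent bound

CC-⊤≥1 : ∀ G → 1 ℕ.≤ CC G ⊤
CC-⊤≥1 G@record { order = suc _ } = List.filter-some (isRepresentative? G ⊤)
  (List.lose (List.∈-allFin (root G ⊤ zero)) (root-isRepresentative G ⊤ ∈⊤))

componentCount : ∀ G → Subset (order G) → ℚ
componentCount G = ι ∘ CC G

coefficients : ∀ F G → (V F → V G) → Subset (order G) → ℚ
coefficients F G φ A = ι (CC F (preimage φ A))

Program : Graph → Graph → Set
Program F G = Solution (componentCount G) (List.map (coefficients F G) (Hom F G))

-- All weight is put on `⊤`. As `G` has a vertex, `CC G ⊤` is positive and can be inverted, and `⊤`
-- differs from `⊥`.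
someWeighting : ∀ G → ∃ (Weighting (componentCount G))
someWeighting G = (λ A → k ℚ.* δ ⊤ A) , record
  { nonNeg = λ A → 0≤* 0≤k (0≤δ ⊤ A)
  ; at-⊥   = ℚ.≤-reflexive (trans (cong (k ℚ.*_) (δ⊤⊥ G)) (ℚ.*-zeroʳ k))
  ; total  = begin
      ⟨ b , (λ A → k ℚ.* δ ⊤ A) ⟩  ≡⟨ ⟨,⟩-*ʳ b k (δ ⊤) ⟩
      k ℚ.* ⟨ b , δ ⊤ ⟩            ≡⟨ cong (k ℚ.*_) (∑-cong λ A → ℚ.*-comm (b A) (δ ⊤ A)) ⟩
      k ℚ.* ⟨ δ ⊤ , b ⟩            ≡⟨ cong (k ℚ.*_) (⟨δ,⟩ ⊤ b) ⟩
      k ℚ.* b ⊤                    ≡⟨ ℚ.*-inverseˡ (b ⊤) ⟩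
      1ℚ                           ∎
  }
  where
  open ≡-Reasoning
  b = componentCount G
  instance
    b-pos : ℚ.Positive (b ⊤)
    b-pos = ℚ.positive (0<ι (CC-⊤≥1 G))
    b≢0 : ℚ.NonZero (b ⊤)
    b≢0 = ℚ.pos⇒nonZero (b ⊤)
  k = ℚ.1/ b ⊤
  0≤k : 0ℚ ℚ.≤ k
  0≤k = ℚ.<⇒≤ (ℚ.positive⁻¹ k {{ℚ.1/pos⇒pos (b ⊤)}})
  δ⊤⊥ : ∀ G → δ {order G} ⊤ ⊥ ≡ 0ℚ
  δ⊤⊥ record { order = suc _ } = refl

program : ∀ F G → Program F G
program F G = MinMax.solution (componentCount G) _ (proj₂ (someWeighting G))

module _ (F G : Graph) (optimal : Program F G) where

  open Solution optimal
  open Weighting weighting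

  optimal𝒬 : 𝒬 G
  optimal𝒬 = record
    { weight     = fromℚ ∘ q
    ; weight-⊥   = (λ r<q⊥ → ℚ.<-≤-trans r<q⊥ at-⊥) , (λ r<0 → ℚ.<-≤-trans r<0 (nonNeg ⊥))
    ; weight-≥0  = λ A r<0 → ℚ.<-≤-trans r<0 (nonNeg A)
    ; normalised =
        (λ {r} r∈ → subst (r ℚ.<_) total (≽-∑⊆-· q (fromℚ ∘ q) (CC G) (λ _ h → h) r∈))
      , (λ {r} r<1 → ≼-∑⊆-· q (fromℚ ∘ q) (CC G) (λ _ h → h) (subst (r ℚ.<_) (sym total) r<1))
    }

  objective-optimal : objective F G optimal𝒬 ≤ cut (fromℚ t)
  objective-optimal {r} r∈ =
    let φ , φ∈ , r∈φ = find (Any.map⁻ (Below-max⁻ (List.map (value F G optimal𝒬) (Hom F G)) r∈))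
    in ℚ.<-≤-trans
      (≽-∑⊆-· q (fromℚ ∘ q) (CC F ∘ preimage φ) (λ _ h → h) r∈φ)
      (All.lookup bound (List.∈-map⁺ (coefficients F G) φ∈))

  module _ (F⟶G : F ⟶ G) where

    private
      someHom : ∃ (List._∈ Hom F G)
      someHom = _ , List.∈-lookup (Fin.fromℕ< F⟶G)

    -- Since `r < t`, there is room for a factor `s < 1` with `r < s t`. The weights of `Q` have
    -- rational approximations from below with total above `s`; by `exceeds` some `φ` gives these a
    -- value above `r`, and the value under `Q` is no smaller.
    ≤objective : ∀ Q → cut (fromℚ t) ≤ objective F G Q
    ≤objective Q {r} r<t =
      let s , r<st , s<1 = scale
          q′ , q′≥0 , q′≼ , s<total =
            approximate-∑⊆ (weight Q) (weight-≥0 Q) (CC G) (proj₂ (normalised Q) s<1)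
          -- If `q′ ⊥` were positive, 0 would lie in the cut of `weight Q ⊥`, which is that of zero.
          q′⊥≤0 = ℚ.≮⇒≥ λ 0<q′⊥ → ℚ.<-irrefl refl (proj₁ (weight-⊥ Q) (q′≼ ⊥ 0<q′⊥))
          exceed = MinMax.exceeds (componentCount G) _ optimal
            (_ , List.∈-map⁺ (coefficients F G) (proj₂ someHom))
            (All.map⁺ (All.tabulate λ {φ} _ A → 0≤ι (CC F (preimage φ A))))
            (λ A → 0≤ι (CC G A)) {q′} q′≥0 q′⊥≤0
            (ℚ.<-≤-trans r<st (ℚ.*-monoʳ-≤-nonNeg t {{ℚ.nonNegative 0≤t}} (ℚ.<⇒≤ s<total)))
      in Below-max⁺ (Any.map⁺ (Any.map
           (λ {φ} → ≼-∑⊆-· q′ (weight Q) (CC F ∘ preimage φ) q′≼) (Any.map⁻ exceed)))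
      where
      -- For `t > 0` any `s` between `r / t` and 1 works; for `t = 0` the rational `r` is negative
      -- and `s = 0` works.
      scale : ∃ λ s → r ℚ.< s ℚ.* t × s ℚ.< 1ℚ
      scale with 0ℚ ℚ.<? t
      ... | no ¬0<t =
        0ℚ , subst (r ℚ.<_) (trans (ℚ.≤-antisym (ℚ.≮⇒≥ ¬0<t) 0≤t) (sym (ℚ.*-zeroˡ t))) r<t ,
             ℚ.positive⁻¹ 1ℚ
      ... | yes 0<t = let s , r/t<s , s<1 = ℚ.<-dense r/t<1 in
        s , subst (ℚ._< s ℚ.* t) (cancel r) (ℚ.*-monoˡ-<-pos t r/t<s) , s<1
        where
        instance
          t-pos : ℚ.Positive t
          t-pos = ℚ.positive 0<t
          t≢0 : ℚ.NonZero t
          t≢0 = ℚ.pos⇒nonZero t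
          i-pos : ℚ.Positive (ℚ.1/ t)
          i-pos = ℚ.1/pos⇒pos t
        cancel : ∀ r → r ℚ.* (ℚ.1/ t) ℚ.* t ≡ r
        cancel r = trans (ℚ.*-assoc r (ℚ.1/ t) t)
          (trans (cong (r ℚ.*_) (ℚ.*-inverseˡ t)) (ℚ.*-identityʳ r))
        r/t<1 : r ℚ.* (ℚ.1/ t) ℚ.< 1ℚ
        r/t<1 = subst (r ℚ.* (ℚ.1/ t) ℚ.<_) (ℚ.*-inverseʳ t) (ℚ.*-monoˡ-<-pos (ℚ.1/ t) r<t)

  -- A negative exponent is below `0 ≤ t`. For `s = p / d` with `t < s`, the blow-ups turn the
  -- hypothesis into `N ^ (D p) ≤ (hom F G * N ^ E) ^ d` for all positive `N`, hence `D p ≤ E d`,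
  -- against the choice of `E`.
  ratPow≤⇒≤ : ∀ {s} → (∀ T → 1 ℕ.≤ hom G T → RatPow≤ (hom G T) s (hom F T)) → s ℚ.≤ t
  ratPow≤⇒≤ {mkℚ -[1+ p ] d-1 c} _ = ℚ.≤-trans (ℚ.<⇒≤ (ℚ.negative⁻¹ _)) 0≤t
  ratPow≤⇒≤ {s@(mkℚ (+ p) d-1 c)} pow = ℚ.≮⇒≥ λ t<s →
    ℕ.<-irrefl refl (ℕ.<-≤-trans (Ed<Dp t<s) (exponent-≤ (D ℕ.* p) E (hom F G) d (growth t<s)))
    where
    denominators : ∃₂ λ D (w : Subset _ → ℕ) → 1 ℕ.≤ D × (∀ A → ι (w A) ≡ ι D ℚ.* q A)
    denominators = commonDenominator q nonNeg
    D : ℕ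
    D = proj₁ denominators
    w : Subset (order G) → ℕ
    w = proj₁ (proj₂ denominators)
    D≥1 : 1 ℕ.≤ D
    D≥1 = proj₁ (proj₂ (proj₂ denominators))
    w≡ : ∀ A → ι (w A) ≡ ι D ℚ.* q A
    w≡ = proj₂ (proj₂ (proj₂ denominators))
    d = suc d-1
    slots = slotsOf w
    -- If t < p / d, this is the largest E with E d < D p.
    E = ℕ.pred (D ℕ.* p) ℕ./ d

    ι-sum-slots : ∀ g → ι (sum (List.map g slots)) ≡ ι D ℚ.* ⟨ ι ∘ g , q ⟩
    ι-sum-slots g = trans (ι-sum-slotsOf g w)
      (trans (∑-cong λ A → cong (ι (g A) ℚ.*_) (w≡ A)) (⟨,⟩-*ʳ (ι ∘ g) (ι D) q))

    sum-CC : sum (List.map (CC G) slots) ≡ D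
    sum-CC = ℕ.≤-antisym (ι-cancel-≤ (ℚ.≤-reflexive eq)) (ι-cancel-≤ (ℚ.≤-reflexive (sym eq)))
      where eq = trans (ι-sum-slots (CC G)) (trans (cong (ι D ℚ.*_) total) (ℚ.*-identityʳ (ι D)))

    module _ (t<s : t ℚ.< s) where

      open ℚ.≤-Reasoning

      small : ∀ k → ι k ℚ.≤ ι D ℚ.* t → k ℕ.* d ℕ.< D ℕ.* p
      small k k≤ = ι-cancel-< (begin-strict
        ι (k ℕ.* d)            ≡⟨ ι-* k d ⟩
        ι k ℚ.* ι d            ≤⟨ ℚ.*-monoʳ-≤-nonNeg (ι d) k≤ ⟩
        ι D ℚ.* t ℚ.* ι d      <⟨ ℚ.*-monoˡ-<-pos (ι d) (ℚ.*-monoʳ-<-pos (ι D) {{ℚ.positive (0<ι D≥1)}} t<s) ⟩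
        ι D ℚ.* s ℚ.* ι d      ≡⟨ ℚ.*-assoc (ι D) s (ι d) ⟩
        ι D ℚ.* (s ℚ.* ι d)    ≡⟨ cong (ι D ℚ.*_) (mkℚ-*-denominator p d-1 c) ⟩
        ι D ℚ.* ι p            ≡⟨ ι-* D p ⟨
        ι (D ℕ.* p)            ∎)

      Ed<Dp : E ℕ.* d ℕ.< D ℕ.* p
      Ed<Dp = ℕ.≤-<-trans (ℕ.m/n*n≤m (ℕ.pred (D ℕ.* p)) d)
        (ℕ.≤-reflexive (ℕ.suc-pred _ {{ℕ.>-nonZero 0<Dp}}))
        -- The case `k = 0` makes `D p` positive, so that its predecessor is a true one.
        where 0<Dp = small 0 (0≤* (0≤ι D) 0≤t)

      E-bound : ∀ {φ} → φ List.∈ Hom F G → sum (List.map (CC F ∘ preimage φ) slots) ℕ.≤ E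
      E-bound {φ} φ∈ = ℕ.≤-trans (ℕ.≤-reflexive (sym (ℕ.m*n/n≡m k d)))
        (ℕ./-monoˡ-≤ d (ℕ.<⇒≤pred (small k (begin
          ι k                            ≡⟨ ι-sum-slots (CC F ∘ preimage φ) ⟩
          ι D ℚ.* ⟨ coefficients F G φ , q ⟩
            ≤⟨ ℚ.*-monoˡ-≤-nonNeg (ι D) (All.lookup bound (List.∈-map⁺ (coefficients F G) φ∈)) ⟩
          ι D ℚ.* t                      ∎))))
        where k = sum (List.map (CC F ∘ preimage φ) slots)

      growth : ∀ N-1 → suc N-1 ℕ.^ (D ℕ.* p) ℕ.≤ (hom F G ℕ.* suc N-1 ℕ.^ E) ℕ.^ d
      growth N-1 = ℕR.begin
        N ℕ.^ (D ℕ.* p)                  ℕR.≡⟨ ℕ.^-*-assoc N D p ⟨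
        (N ℕ.^ D) ℕ.^ p                  ℕR.≤⟨ ℕ.^-monoˡ-≤ p N^D≤ ⟩
        hom G T ℕ.^ p                    ℕR.≤⟨ pow T (ℕ.≤-trans (ℕ.m^n>0 N D) N^D≤) ⟩
        hom F T ℕ.^ d                    ℕR.≤⟨ ℕ.^-monoˡ-≤ d (hom-blowUp-≤ F E E-bound) ⟩
        (hom F G ℕ.* N ℕ.^ E) ℕ.^ d      ℕR.∎
        where
        module ℕR = ℕ.≤-Reasoning
        open BlowUp G slots N-1
        T = blowUp
        N^D≤ : N ℕ.^ D ℕ.≤ hom G T
        N^D≤ = subst (λ k → N ℕ.^ k ℕ.≤ hom G T) sum-CC hom-blowUp-≥

  HDE≤ : HDE F G ≤ cut (fromℚ t)
  HDE≤ (c , dominates , r∈c) =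
    -- Rational exponents in the cut are only shown to be at most `t`; openness supplies a larger
    -- one, and with it the strict inequality for `r`.
    let s , r<s , s∈c = open′ (cut c) r∈c
    in ℚ.<-≤-trans r<s (ratPow≤⇒≤ λ T 1≤ → dominates T 1≤ s∈c)

theorem3p2 : (F G : Graph) → F ⟶ G →
    ∃ λ (m : ℝ) → IsMinimum (objective F G) m × HDE F G ≤ cut m
theorem3p2 F G F⟶G = fromℚ (Solution.t opt) ,
  ((optimal𝒬 F G opt , objective-optimal F G opt , ≤objective F G opt F⟶G (optimal𝒬 F G opt))
    , ≤objective F G opt F⟶G) ,
  HDE≤ F G opt
  where opt = program F G
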